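{- Let $\mathbb{F}$ be a field, $T\subseteq \mathbb{F}$ a finite subset with $0\in T$ and $|T|\geq 2$, $d\geq 2$ an integer, and $t$ a positive integer. Then $$ar_\ell(T^d,t)=\begin{cases}|T|^d & \text{if } t>\frac{|T|^d-1}{d},\\ 1+t(d-1) & \text{if } t(d-2)\geq |T|^{d-2}-1 \text{ and } t\leq\frac{|T|^d-1}{d},\\ |T|^{d-2}+t & \text{if } t(d-2)\leq |T|^{d-2}-1.\end{cases}$$
   Context: $T^d\subseteq\mathbb{F}^d$ is the set of vectors all of whose coordinates lie in $T$. For a finite set $E\subseteq\mathbb{F}^d$ spanning $\mathbb{F}^d$, a basis of $E$ is a linearly independent subset of $E$ of size $d$; given a coloring of $E$, a rainbow basis is such a basis whose elements have pairwise distinct colors, and $ar_\ell(E,t)$ is the maximum number $m$ such that there is a coloring of $E$ with exactly $m$ colors containing no $t$ pairwise disjoint rainbow bases.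
   Formalization: The third case is stated under the additional condition t ≤ (|T|^d−1)/d: this is automatic for d ≥ 3, but for d = 2 the third condition always holds and would contradict the first case (e.g. |T| = 2, d = 2, t = 2 would give both 4 and 3). -}

module Defs where

open import Level using (Level; _⊔_)
open import Algebra.Bundles using (CommutativeRing)
open import Data.Nat using (ℕ; _≤_)
open ℕ
open import Data.Fin using (Fin)
open Fin
open import Data.Vec using (Vec; lookup)
open import Data.Product using (Σ; Σ-syntax; _×_; ∃-syntax)
open import Relation.Binary.PropositionalEquality using (_≡_)
open import Relation.Nullary using (¬_)
open import Function.Definitions using (Injective; Surjective)

record Field (c ℓ : Level) : Set (Level.suc (c ⊔ ℓ)) where
  field
    commutativeRing : CommutativeRing c ℓ
  open CommutativeRing commutativeRing public
  field
    1≉0     : ¬ (1# ≈ 0#)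
    inverse : ∀ x → ¬ (x ≈ 0#) → Σ[ y ∈ Carrier ] (x * y ≈ 1#)

module _ {c ℓ : Level} (F : Field c ℓ) where
  open Field F using (Carrier; _≈_; _+_; _*_; 0#)

  ∑ : (n : ℕ) → (Fin n → Carrier) → Carrier
  ∑ zero    f = 0#
  ∑ (suc n) f = f zero + ∑ n (λ i → f (suc i))

  LinearlyIndependent : (d n : ℕ) → (Fin n → Fin d → Carrier) → Set (c ⊔ ℓ)
  LinearlyIndependent d n v =
    (a : Fin n → Carrier) →
    (∀ (l : Fin d) → ∑ n (λ i → a i * v i l) ≈ 0#) →
    ∀ (i : Fin n) → a i ≈ 0#

  -- A finite subset T ⊆ F with k elements is given by an injective
  -- enumeration τ : Fin k → F.  An element of T^d is encoded by its
  -- vector of indices x : Vec (Fin k) d; the actual vector in F^d is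
  -- l ↦ τ (lookup x l).  Since τ is injective this encoding is a bijection.
  module _ {k : ℕ} (τ : Fin k → Carrier) (d : ℕ) where

    Point : Set
    Point = Vec (Fin k) d

    vec : Point → Fin d → Carrier
    vec x l = τ (lookup x l)

    -- Given a coloring col : T^d → Fin m, a rainbow basis is a family of d
    -- elements of T^d with pairwise distinct colours (hence pairwise
    -- distinct elements, i.e. a d-element subset) that is linearly independent.
    RainbowBasis : {m : ℕ} → (Point → Fin m) → (Fin d → Point) → Set (c ⊔ ℓ)
    RainbowBasis col B =
      Injective _≡_ _≡_ (λ i → col (B i)) × LinearlyIndependent d d (λ i → vec (B i))

    DisjointRainbowBases : {m : ℕ} → (Point → Fin m) → (t : ℕ) → Set (c ⊔ ℓ)
    DisjointRainbowBases col t =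
      Σ[ B ∈ (Fin t → Fin d → Point) ]
        ((∀ j → RainbowBasis col (B j)) ×
         (∀ j j' i i' → B j i ≡ B j' i' → j ≡ j'))

    Admissible : (t m : ℕ) → Set (c ⊔ ℓ)
    Admissible t m =
      Σ[ col ∈ (Point → Fin m) ]
        (Surjective _≡_ _≡_ col × ¬ DisjointRainbowBases col t)

    IsAr : (t n : ℕ) → Set (c ⊔ ℓ)
    IsAr t n = Admissible t n × (∀ m → Admissible t m → m ≤ n)

{-# OPTIONS --safe #-}
-- Lower bounds. Colour one set of points with private colours and all other points with one further colour, so
-- that a rainbow basis has all but at most one element in the set. If the set has t (d - 1) points including 0,
-- it is too small for t bases. If it consists of a flat of corank 2 and t - 1 further points, each basis needs one
-- of these t - 1 points, as it has two elements outside the flat.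
--
-- Upper bound. With more colours, choose one point of each colour such that the chosen points span. Flats of rank r
-- contain at most k ^ r points, so by convexity of k ^ r every flat of rank r < d misses at least t (d - 1 - r) + 1 of
-- the chosen points and at least t (d - r) points altogether. By matroid union there are t disjoint independent sets
-- of t (d - 1) + 1 chosen points in total, and they can be enlarged to t disjoint bases whose union still has
-- t (d - 1) + 1 colours. If one of these bases is not rainbow, then the bases linked to it through common colours
-- have too few colours to be all of them; a symmetric exchange with an unlinked basis increases the total number of
-- colours seen by the single bases, so after finitely many exchanges all bases are rainbow.
--
-- Equality in F is not decidable, hence the upper bound is proved up to double negation, which suffices because
-- _≤_ on ℕ is stable.
module Submission where

open import Defs
open import Level using (Level; _⊔_)
open import Data.Bool using (Bool; true; false)
open import Data.Empty using (⊥; ⊥-elim)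
open import Data.Fin using (Fin; zero; suc; toℕ; fromℕ<; punchIn; punchOut; combine; remQuot; funToFin; finToFun; inject≤)
open import Data.Fin.Permutation.Components using (transpose; transpose-inverse)
open import Data.Fin.Properties
  using (injective⇒≤; suc-injective; any?; _≟_; sequence; toℕ<n; punchInᵢ≢i; punchIn-punchOut; punchIn-injective; toℕ-injective; toℕ-fromℕ<; toℕ-↑ˡ; toℕ-↑ʳ; combine-remQuot; funToFin-finToFin; finToFun-funToFin; inject≤-injective; ¬Fin0)
open import Data.List using (List; []; _∷_; allFin)
import Data.List.Membership.DecPropositional as DecMembership
open import Data.List.Membership.Propositional using (_∈_)
open import Data.List.Membership.Propositional.Properties using (∈-allFin)
open import Data.List.Relation.Unary.Any using (here; there)
open import Data.Maybe using (Maybe; just; nothing)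
open import Data.Maybe.Properties using (just-injective; ≡-dec)
open import Data.Nat using (ℕ; zero; suc; _∸_; _^_; _≤_; _<_; z≤n; s≤s; _⊓_; _<?_; _≤?_; NonZero; >-nonZero)
open import Data.Nat.Solver using (module +-*-Solver)
open import Data.Product using (Σ-syntax; ∃-syntax; _×_; _,_; proj₁; proj₂; uncurry)
open import Data.Sum using (_⊎_; inj₁; inj₂; [_,_]′)
open import Data.Unit using (⊤; tt)
open import Data.Vec using (Vec; []; _∷_; lookup; tabulate)
open import Data.Vec.Functional using (insertAt)
open import Data.Vec.Functional.Properties using (insertAt-lookup; insertAt-punchIn)
open import Data.Vec.Properties using (lookup∘tabulate; tabulate∘lookup; tabulate-cong)
open import Effect.Monad using (RawMonad)
open import Function using (_∘_; id; case_of_)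
open import Function.Definitions using (Injective; Surjective)
open import Relation.Binary.Definitions using (tri<; tri≈; tri>)
open import Relation.Binary.PropositionalEquality as ≡ using (_≡_; _≢_; _≗_)
open import Relation.Nullary using (¬_; Dec; yes; no; does; contradiction; ¬?; _×-dec_; _⊎-dec_; _→-dec_)
open import Relation.Nullary.Decidable using (decidable-stable; map′; True; toWitness; fromWitness; ¬¬-excluded-middle) renaming (T? to T-dec)
open import Relation.Nullary.Negation using (¬¬-Monad)
open import Relation.Unary using (Decidable)

module Combinatorics where

  open import Data.Nat using (_+_; _*_)
  open import Data.Nat.Properties hiding (suc-injective; _≟_)
  open ≡ using (refl; sym; trans; cong; cong₂; subst)

  private
    variable
      ℓ₁ ℓ₂ ℓ₃ : Level
      n : ℕ

  -- Cardinalities of decidable subsets of Fin n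

  indicator : ∀ {a} {A : Set a} → Dec A → ℕ
  indicator (yes _) = 1
  indicator (no _)  = 0

  count : {P : Fin n → Set ℓ₁} → Decidable P → ℕ
  count {n = zero}  P? = 0
  count {n = suc n} P? = indicator (P? zero) + count (P? ∘ suc)

  count-mono : {P : Fin n → Set ℓ₁} {Q : Fin n → Set ℓ₂} (P? : Decidable P) (Q? : Decidable Q) → (∀ i → P i → Q i) → count P? ≤ count Q?
  count-mono {n = zero} P? Q? f = z≤n
  count-mono {n = suc n} P? Q? f with P? zero | Q? zero
  ... | yes a | yes b = s≤s (count-mono (P? ∘ suc) (Q? ∘ suc) (f ∘ suc))
  ... | yes a | no ¬b = contradiction (f zero a) ¬b
  ... | no ¬a | yes b = m≤n⇒m≤1+n (count-mono (P? ∘ suc) (Q? ∘ suc) (f ∘ suc))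
  ... | no ¬a | no ¬b = count-mono (P? ∘ suc) (Q? ∘ suc) (f ∘ suc)

  count-cover : {P : Fin n → Set ℓ₁} {Q : Fin n → Set ℓ₂} {R : Fin n → Set ℓ₃} (P? : Decidable P) (Q? : Decidable Q) (R? : Decidable R) →
    (∀ i → P i → Q i ⊎ R i) → count P? ≤ count Q? + count R?
  count-cover {n = zero} P? Q? R? f = z≤n
  count-cover {n = suc n} P? Q? R? f with ih ← count-cover (P? ∘ suc) (Q? ∘ suc) (R? ∘ suc) (f ∘ suc) | P? zero | Q? zero | R? zero
  ... | yes a | yes b | yes c = s≤s (≤-trans ih (+-monoʳ-≤ _ (n≤1+n _)))
  ... | yes a | yes b | no ¬c = s≤s ih
  ... | yes a | no ¬b | yes c = ≤-trans (s≤s ih) (≤-reflexive (sym (+-suc _ _)))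
  ... | yes a | no ¬b | no ¬c = contradiction (f zero a) [ ¬b , ¬c ]′
  ... | no ¬a | yes b | yes c = m≤n⇒m≤1+n (≤-trans ih (+-monoʳ-≤ _ (n≤1+n _)))
  ... | no ¬a | yes b | no ¬c = m≤n⇒m≤1+n ih
  ... | no ¬a | no ¬b | yes c = ≤-trans ih (+-monoʳ-≤ _ (n≤1+n _))
  ... | no ¬a | no ¬b | no ¬c = ih

  count-disjoint : {P : Fin n → Set ℓ₁} {Q : Fin n → Set ℓ₂} {R : Fin n → Set ℓ₃} (P? : Decidable P) (Q? : Decidable Q) (R? : Decidable R) →
    (∀ i → Q i → P i) → (∀ i → R i → P i) → (∀ i → Q i → ¬ R i) → count Q? + count R? ≤ count P?
  count-disjoint {n = zero} P? Q? R? f g h = z≤n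
  count-disjoint {n = suc n} P? Q? R? f g h
    with ih ← count-disjoint (P? ∘ suc) (Q? ∘ suc) (R? ∘ suc) (f ∘ suc) (g ∘ suc) (h ∘ suc) | P? zero | Q? zero | R? zero
  ... | yes a | yes b | yes c = contradiction c (h zero b)
  ... | yes a | yes b | no ¬c = s≤s ih
  ... | yes a | no ¬b | yes c = ≤-trans (≤-reflexive (+-suc _ _)) (s≤s ih)
  ... | yes a | no ¬b | no ¬c = m≤n⇒m≤1+n ih
  ... | no ¬a | yes b | _     = contradiction (f zero b) ¬a
  ... | no ¬a | no ¬b | yes c = contradiction (g zero c) ¬a
  ... | no ¬a | no ¬b | no ¬c = ih

  enum : {P : Fin n → Set ℓ₁} (P? : Decidable P) → Fin (count P?) → Fin n
  enum {n = suc n} P? i with P? zero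
  enum {n = suc n} P? zero    | yes _ = zero
  enum {n = suc n} P? (suc i) | yes _ = suc (enum (P? ∘ suc) i)
  enum {n = suc n} P? i       | no _  = suc (enum (P? ∘ suc) i)

  enum-∈ : {P : Fin n → Set ℓ₁} (P? : Decidable P) (i : Fin (count P?)) → P (enum P? i)
  enum-∈ {n = suc n} P? i with P? zero
  enum-∈ {n = suc n} P? zero    | yes a = a
  enum-∈ {n = suc n} P? (suc i) | yes _ = enum-∈ (P? ∘ suc) i
  enum-∈ {n = suc n} P? i       | no _  = enum-∈ (P? ∘ suc) i

  enum-injective : {P : Fin n → Set ℓ₁} (P? : Decidable P) → Injective _≡_ _≡_ (enum P?)
  enum-injective {n = suc n} P? {i} {j} eq with P? zero
  enum-injective {n = suc n} P? {zero} {zero} eq  | yes _ = refl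
  enum-injective {n = suc n} P? {suc i} {suc j} eq | yes _ = cong suc (enum-injective (P? ∘ suc) (suc-injective eq))
  enum-injective {n = suc n} P? {i} {j} eq        | no _ = enum-injective (P? ∘ suc) (suc-injective eq)

  index : {P : Fin n → Set ℓ₁} (P? : Decidable P) → ∀ e → P e → Fin (count P?)
  index {n = suc n} P? zero pe with P? zero
  ... | yes _ = zero
  ... | no ¬a = contradiction pe ¬a
  index {n = suc n} P? (suc e) pe with P? zero
  ... | yes _ = suc (index (P? ∘ suc) e pe)
  ... | no ¬a = index (P? ∘ suc) e pe

  enum-index : {P : Fin n → Set ℓ₁} (P? : Decidable P) → ∀ e (pe : P e) → enum P? (index P? e pe) ≡ e
  enum-index {n = suc n} P? zero pe with P? zero
  ... | yes _ = refl
  ... | no ¬a = contradiction pe ¬a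
  enum-index {n = suc n} P? (suc e) pe with P? zero
  ... | yes _ = cong suc (enum-index (P? ∘ suc) e pe)
  ... | no ¬a = cong suc (enum-index (P? ∘ suc) e pe)

  injection⇒≤count : ∀ {m} {P : Fin n → Set ℓ₁} (P? : Decidable P) (f : Fin m → Fin n) → Injective _≡_ _≡_ f →
    (∀ i → P (f i)) → m ≤ count P?
  injection⇒≤count P? f inj f∈ = injective⇒≤ {f = λ i → index P? (f i) (f∈ i)} λ {i} {j} eq →
    inj (trans (sym (enum-index P? _ (f∈ i))) (trans (cong (enum P?) eq) (enum-index P? _ (f∈ j))))

  count-all : {P : Fin n → Set ℓ₁} (P? : Decidable P) → (∀ i → P i) → n ≤ count P?
  count-all P? f = injection⇒≤count P? id id f

  count≤n : {P : Fin n → Set ℓ₁} (P? : Decidable P) → count P? ≤ n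
  count≤n P? = injective⇒≤ (enum-injective P?)

  count-none : {P : Fin n → Set ℓ₁} (P? : Decidable P) → (∀ i → ¬ P i) → count P? ≡ 0
  count-none {n = zero} P? f = refl
  count-none {n = suc n} P? f with P? zero
  ... | yes a = contradiction a (f zero)
  ... | no _  = count-none (P? ∘ suc) (f ∘ suc)

  count-singleton : (x : Fin n) → count (_≟ x) ≤ 1
  count-singleton x = injective⇒≤ {f = λ _ → zero} λ {i} {j} _ →
    enum-injective (_≟ x) (trans (enum-∈ (_≟ x) i) (sym (enum-∈ (_≟ x) j)))

  infixl 6 _⊝_ _⊕_

  _⊝_ : (Fin n → Set ℓ₁) → Fin n → Fin n → Set ℓ₁
  (P ⊝ x) e = P e × e ≢ x

  _⊕_ : (Fin n → Set ℓ₁) → Fin n → Fin n → Set ℓ₁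
  (P ⊕ x) e = P e ⊎ e ≡ x

  ⊝-dec : {P : Fin n → Set ℓ₁} → Decidable P → ∀ x → Decidable (P ⊝ x)
  ⊝-dec P? x e = P? e ×-dec ¬? (e ≟ x)

  ⊕-dec : {P : Fin n → Set ℓ₁} → Decidable P → ∀ x → Decidable (P ⊕ x)
  ⊕-dec P? x e = P? e ⊎-dec (e ≟ x)

  diff? : {P : Fin n → Set ℓ₁} {Q : Fin n → Set ℓ₂} → Decidable P → Decidable Q → Decidable (λ e → P e × ¬ Q e)
  diff? P? Q? e = P? e ×-dec ¬? (Q? e)

  count-⊝ : {P : Fin n → Set ℓ₁} (P? : Decidable P) → ∀ x → count P? ≤ suc (count (⊝-dec P? x))
  count-⊝ {P = P} P? x = ≤-trans (count-cover P? (_≟ x) (⊝-dec P? x) split) (+-monoˡ-≤ _ (count-singleton x))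
    where
    split : ∀ i → P i → i ≡ x ⊎ (P ⊝ x) i
    split i pi with i ≟ x
    ... | yes eq = inj₁ eq
    ... | no neq = inj₂ (pi , neq)

  count-positive : {P : Fin n → Set ℓ₁} (P? : Decidable P) → ∀ {x} → P x → 1 ≤ count P?
  count-positive P? {x} px = injection⇒≤count P? (λ (_ : Fin 1) → x) (λ { {zero} {zero} _ → refl }) λ _ → px

  count-extend : {P : Fin n → Set ℓ₁} {Q : Fin n → Set ℓ₂} (P? : Decidable P) (Q? : Decidable Q) → ∀ x →
    (∀ i → P i → Q i) → Q x → ¬ P x → suc (count P?) ≤ count Q?
  count-extend P? Q? x P⊆Q qx ¬px =
    ≤-trans (+-monoˡ-≤ _ (count-positive (_≟ x) refl))
      (count-disjoint Q? (_≟ x) P? (λ { i refl → qx }) P⊆Q λ { i refl px → ¬px px })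

  -- Sums of natural numbers over Fin t

  sumℕ : ∀ {t} → (Fin t → ℕ) → ℕ
  sumℕ {zero} f = 0
  sumℕ {suc t} f = f zero + sumℕ (f ∘ suc)

  sumℕ-mono : ∀ {t} {f g : Fin t → ℕ} → (∀ i → f i ≤ g i) → sumℕ f ≤ sumℕ g
  sumℕ-mono {zero} h = z≤n
  sumℕ-mono {suc t} h = +-mono-≤ (h zero) (sumℕ-mono (h ∘ suc))

  sumℕ-strict : ∀ {t} {f g : Fin t → ℕ} → (∀ i → f i ≤ g i) → ∀ j → f j < g j → sumℕ f < sumℕ g
  sumℕ-strict {suc t} h zero lt = +-mono-<-≤ lt (sumℕ-mono (h ∘ suc))
  sumℕ-strict {suc t} h (suc j) lt = +-mono-≤-< (h zero) (sumℕ-strict (h ∘ suc) j lt)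

  sumℕ-const : ∀ t b → sumℕ {t} (λ _ → b) ≡ t * b
  sumℕ-const zero b = refl
  sumℕ-const (suc t) b = cong (b +_) (sumℕ-const t b)

  count-cover-family : ∀ {t} {P : Fin n → Set ℓ₁} {Q : Fin t → Fin n → Set ℓ₂} (P? : Decidable P) (Q? : ∀ i → Decidable (Q i)) →
    (∀ e → P e → ∃[ i ] Q i e) → count P? ≤ sumℕ (λ i → count (Q? i))
  count-cover-family {t = zero} P? Q? f = ≤-reflexive (count-none P? λ e pe → ¬Fin0 (proj₁ (f e pe)))
  count-cover-family {t = suc t} {Q = Q} P? Q? f =
    ≤-trans (count-cover P? (Q? zero) rest? split) (+-monoʳ-≤ _ (count-cover-family rest? (Q? ∘ suc) (λ _ → id)))
    where
    rest? : Decidable (λ e → ∃[ i ] Q (suc i) e)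
    rest? e = any? λ i → Q? (suc i) e
    split : ∀ e → _ → Q zero e ⊎ (∃[ i ] Q (suc i) e)
    split e pe with f e pe
    ... | zero , q = inj₁ q
    ... | suc i , q = inj₂ (i , q)

  count-disjoint-family : ∀ {t r} {P : Fin n → Set ℓ₁} {Q : Fin t → Fin n → Set ℓ₂} (P? : Decidable P) (Q? : ∀ i → Decidable (Q i)) →
    (∀ i e → Q i e → P e) → (∀ i j e → Q i e → Q j e → i ≡ j) → (∀ i → r ≤ count (Q? i)) → t * r ≤ count P?
  count-disjoint-family {t = zero} P? Q? Q⊆P dis big = z≤n
  count-disjoint-family {t = suc t} {Q = Q} P? Q? Q⊆P dis big =
    ≤-trans (+-mono-≤ (big zero) (count-disjoint-family rest? (Q? ∘ suc) (λ i e q → i , q)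
        (λ i j e q q' → suc-injective (dis (suc i) (suc j) e q q')) (big ∘ suc)))
      (count-disjoint P? (Q? zero) rest? (Q⊆P zero) (λ { e (i , q) → Q⊆P (suc i) e q })
        λ { e q (i , q') → contradiction (dis zero (suc i) e q q') λ () })
    where
    rest? : Decidable (λ e → ∃[ i ] Q (suc i) e)
    rest? e = any? λ i → Q? (suc i) e

  -- Matroids given by their closure operator

  ¬¬-∀ : ∀ {n ℓ} {P : Fin n → Set ℓ} → (∀ i → ¬ ¬ P i) → ¬ ¬ (∀ i → P i)
  ¬¬-∀ = sequence (RawMonad.rawApplicative ¬¬-Monad)

  record Matroid (N : ℕ) (ℓ : Level) : Set (Level.suc ℓ) where
    field
      cl       : (Fin N → Set) → Fin N → Set ℓ
      cl?      : ∀ {P} → Decidable P → Decidable (cl P)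
      cl-incl  : ∀ {P e} → P e → cl P e
      cl-trans : ∀ {P Q} → (∀ e → P e → cl Q e) → ∀ {x} → cl P x → cl Q x
      cl-exch  : ∀ {P} → Decidable P → ∀ {x y} → cl (P ⊕ y) x → ¬ cl P x → cl (P ⊕ x) y

    private
      variable
        P Q S T V X D : Fin N → Set
        x y : Fin N

    cl-mono : (∀ e → P e → Q e) → cl P x → cl Q x
    cl-mono f = cl-trans λ e pe → cl-incl (f e pe)

    Ind : (Fin N → Set) → Set ℓ
    Ind P = ∀ e → P e → ¬ cl (P ⊝ e) e

    ind-⊆ : (∀ e → Q e → P e) → Ind P → Ind Q
    ind-⊆ f ind e qe c = ind e (f e qe) (cl-mono (λ { _ (q , ne) → f _ q , ne }) c)

    ind-⊕ : Decidable P → Ind P → ¬ cl P x → Ind (P ⊕ x)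
    ind-⊕ P? ind ¬c e (inj₂ refl) c =
      ¬c (cl-mono (λ { _ (inj₁ p , _) → p ; _ (inj₂ eq , ne) → contradiction eq ne }) c)
    ind-⊕ P? ind ¬c e (inj₁ pe) c =
      ¬c (cl-mono (λ { _ (inj₁ (p , _)) → p ; _ (inj₂ refl) → pe })
        (cl-exch (⊝-dec P? e) (cl-mono (λ { _ (inj₁ p , ne) → inj₁ (p , ne) ; _ (inj₂ eq , _) → inj₂ eq }) c) (ind e pe)))

    -- Induction on the number of elements of `S` outside `T`. Such an element `x` can be replaced
    -- by some `y` in `T` outside `cl (S ⊝ x)`: if `cl (S ⊝ x)` contained all of `T`, it would
    -- contain `x`, because `T` spans `S`.
    steinitz′ : ∀ n {S T} (S? : Decidable S) (T? : Decidable T) → count (diff? S? T?) ≤ n →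
      Ind S → (∀ e → S e → cl T e) → count S? ≤ count T?
    steinitz′ n S? T? le ind sp with any? (diff? S? T?)
    ... | no none = count-mono S? T? λ e se → decidable-stable (T? e) λ nt → none (e , se , nt)
    steinitz′ zero S? T? le ind sp | yes (x , x∈) =
      contradiction (≤-trans (count-positive (diff? S? T?) x∈) le) λ ()
    steinitz′ (suc n) {S} {T} S? T? le ind sp | yes (x , sx , ¬tx) with any? (λ y → T? y ×-dec ¬? (cl? (⊝-dec S? x) y))
    ... | no none = contradiction
            (cl-trans (λ y ty → decidable-stable (cl? (⊝-dec S? x) y) λ nc → none (y , ty , nc)) (sp x sx)) (ind x sx)
    ... | yes (y , ty , ny) = begin
            count S?                  ≤⟨ count-⊝ S? x ⟩
            suc (count (⊝-dec S? x))  ≤⟨ count-extend (⊝-dec S? x) S′? y (λ _ → inj₁) (inj₂ refl) (ny ∘ cl-incl) ⟩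
            count S′?                 ≤⟨ steinitz′ n S′? T? (≤-pred (≤-trans smaller le)) ind′ sp′ ⟩
            count T?                  ∎
      where
      open ≤-Reasoning
      S′? = ⊕-dec (⊝-dec S? x) y
      smaller : suc (count (diff? S′? T?)) ≤ count (diff? S? T?)
      smaller = count-extend (diff? S′? T?) (diff? S? T?) x
        (λ { e (inj₁ (se , _) , nt) → se , nt ; e (inj₂ refl , nt) → contradiction ty nt }) (sx , ¬tx)
        λ { (inj₁ (_ , ne) , _) → ne refl ; (inj₂ refl , _) → ¬tx ty }
      ind′ : Ind (S ⊝ x ⊕ y)
      ind′ = ind-⊕ (⊝-dec S? x) (ind-⊆ (λ _ → proj₁) ind) ny
      sp′ : ∀ e → (S ⊝ x ⊕ y) e → cl T e
      sp′ e (inj₁ (se , _)) = sp e se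
      sp′ e (inj₂ refl) = cl-incl ty

    steinitz : (S? : Decidable S) (T? : Decidable T) → Ind S → (∀ e → S e → cl T e) → count S? ≤ count T?
    steinitz S? T? = steinitz′ _ S? T? ≤-refl

    basis : Decidable X → Σ[ V ∈ (Fin N → Set) ] Σ[ V? ∈ Decidable V ]
      (Ind V × (∀ e → V e → X e) × (∀ e → X e → cl V e))
    basis {X} X? = let V , V? , ind , V⊆X , sp = greedy (allFin N) in V , V? , ind , V⊆X , λ e → sp e (∈-allFin e)
      where
      greedy : (l : List (Fin N)) → Σ[ V ∈ (Fin N → Set) ] Σ[ V? ∈ Decidable V ]
        (Ind V × (∀ e → V e → X e) × (∀ e → e ∈ l → X e → cl V e))
      greedy [] = (λ _ → ⊥) , (λ _ → no id) , (λ _ ()) , (λ _ ()) , λ _ ()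
      greedy (x ∷ l) with V , V? , ind , V⊆X , sp ← greedy l | X? x | cl? V? x
      ... | yes xx | yes c = V , V? , ind , V⊆X , λ { e (here refl) _ → c ; e (there e∈) → sp e e∈ }
      ... | no ¬xx | _ = V , V? , ind , V⊆X , λ { e (here refl) xx → contradiction xx ¬xx ; e (there e∈) → sp e e∈ }
      ... | yes xx | no ¬c = V ⊕ x , ⊕-dec V? x , ind-⊕ V? ind ¬c ,
              (λ { e (inj₁ v) → V⊆X e v ; e (inj₂ refl) → xx }) ,
              λ { e (here refl) _ → cl-incl (inj₂ refl) ; e (there e∈) xe → cl-mono (λ _ → inj₁) (sp e e∈ xe) }

    -- The elements z of S with x ∉ cl (S ⊝ z) form, together with x, the fundamental circuit of x.
    circuit : Decidable S → Ind S → Decidable D → cl S x →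
      (∀ z → S z → ¬ cl (S ⊝ z) x → D z) → cl (λ e → S e × D e) x
    circuit {S} {D} {x} S? ind D? c h = cl-mono (λ { e (se , f) → se , f (∈-allFin e) }) (shrink (allFin N))
      where
      open DecMembership (_≟_ {N}) using (_∈?_)
      Rest : List (Fin N) → Fin N → Set
      Rest l e = S e × (e ∈ l → D e)
      rest? : ∀ l → Decidable (Rest l)
      rest? l e = S? e ×-dec ((e ∈? l) →-dec D? e)
      shrink : ∀ l → cl (Rest l) x
      shrink [] = cl-mono (λ e se → se , λ ()) c
      shrink (z ∷ l) with cl? (rest? (z ∷ l)) x
      ... | yes c′ = c′
      ... | no ¬c′ with S? z ×-dec ¬? (D? z)
      ...   | no keep = cl-mono (λ { e (se , f) → se , λ { (here refl) → decidable-stable (D? e) λ nd → keep (se , nd)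
                                                       ; (there e∈) → f e∈ } }) (shrink l)
      -- If dropping `z` loses `x`, exchange puts `z` into the closure of the remaining elements and
      -- `x`. As `z` is not in `D`, `h` puts `x` into `cl (S ⊝ z)`, so `z` would depend on the rest
      -- of `S`.
      ...   | yes (sz , ¬dz) = contradiction (cl-trans back (cl-exch (rest? (z ∷ l)) (cl-mono add (shrink l)) ¬c′)) (ind z sz)
        where
        add : ∀ e → Rest l e → (Rest (z ∷ l) ⊕ z) e
        add e (se , f) with e ≟ z
        ... | yes eq = inj₂ eq
        ... | no ne = inj₁ (se , λ { (here eq) → contradiction eq ne ; (there e∈) → f e∈ })
        back : ∀ e → (Rest (z ∷ l) ⊕ x) e → cl (S ⊝ z) e
        back e (inj₁ (se , f)) = cl-incl (se , λ { refl → ¬dz (f (here refl)) })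
        back e (inj₂ refl) = decidable-stable (cl? (⊝-dec S? z) x) λ nc → ¬dz (h z sz nc)

    -- If the fundamental circuit of `x` in `T`, apart from `x`, lay in `cl (S ⊝ x)`, so would `x`,
    -- against the independence of `S`.
    symmetric-exchange : Decidable S → Decidable T → Ind S → Ind T → S x → cl T x →
      ∃[ y ] (T y × ¬ cl (S ⊝ x) y × ¬ cl (T ⊝ y) x)
    symmetric-exchange {S} {T} {x} S? T? indS indT sx c
      with any? (λ y → T? y ×-dec ¬? (cl? (⊝-dec S? x) y) ×-dec ¬? (cl? (⊝-dec T? y) x))
    ... | yes found = found
    -- `True` brings the circuit condition, which lives in `Set ℓ`, down to `Set`, where `cl` takes
    -- its subsets.
    ... | no none = contradiction (cl-trans inside (circuit T? indT (λ y → T-dec _) c (λ y _ → fromWitness))) (indS x sx)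
      where
      inside : ∀ y → T y × True (¬? (cl? (⊝-dec T? y) x)) → cl (S ⊝ x) y
      inside y (ty , d) = decidable-stable (cl? (⊝-dec S? x) y) λ nc → none (y , ty , nc , toWitness d)

  -- Partial assignments of the elements of a finite set to t slots

  Assignment : ℕ → ℕ → Set
  Assignment N t = Fin N → Maybe (Fin t)

  module _ {N t : ℕ} where

    Slot : Assignment N t → Fin t → Fin N → Set
    Slot a i e = a e ≡ just i

    slot? : ∀ a i → Decidable (Slot a i)
    slot? a i e = ≡-dec _≟_ (a e) (just i)

    Used : Assignment N t → Fin N → Set
    Used a e = ∃[ i ] a e ≡ just i

    used? : ∀ a → Decidable (Used a)
    used? a e = any? λ i → slot? a i e

    unused : ∀ {a e} → ¬ Used a e → a e ≡ nothing
    unused {a} {e} ¬u with a e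
    ... | just i = contradiction (i , refl) ¬u
    ... | nothing = refl

    slot-unique : ∀ {a : Assignment N t} {e i j} → a e ≡ just i → a e ≡ just j → i ≡ j
    slot-unique p q = just-injective (trans (sym p) q)

    assign : Assignment N t → Fin N → Maybe (Fin t) → Assignment N t
    assign a x v e with e ≟ x
    ... | yes _ = v
    ... | no _  = a e

    assign-≡ : ∀ (a : Assignment N t) x v → assign a x v x ≡ v
    assign-≡ a x v with x ≟ x
    ... | yes _ = refl
    ... | no ne = contradiction refl ne

    assign-≢ : ∀ {a : Assignment N t} {x v e} → e ≢ x → assign a x v e ≡ a e
    assign-≢ {a} {x} {v} {e} ne with e ≟ x
    ... | yes eq = contradiction eq ne
    ... | no _  = refl

    assign⁻ : ∀ {a : Assignment N t} {x v e w} → assign a x v e ≡ w → (e ≡ x × v ≡ w) ⊎ (e ≢ x × a e ≡ w)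
    assign⁻ {a} {x} {v} {e} eq with e ≟ x
    ... | yes p = inj₁ (p , eq)
    ... | no ne = inj₂ (ne , eq)

  -- Matroid union: packing elements into disjoint independent sets

  module Packing {N ℓ} (M : Matroid N ℓ) {t : ℕ} (slot₀ : Fin t) where
    open Matroid M

    Valid : Assignment N t → Set ℓ
    Valid a = ∀ i → Ind (Slot a i)

    assign-valid : ∀ {a x i} → Valid a → ¬ cl (Slot a i) x → Valid (assign a x (just i))
    assign-valid {a} {x} {i} valid ¬c j with j ≟ i
    ... | yes refl = ind-⊆ (λ e eq → case assign⁻ {a = a} eq of λ { (inj₁ (p , _)) → inj₂ p ; (inj₂ (_ , q)) → inj₁ q })
                       (ind-⊕ (slot? a i) (valid i) ¬c)
    ... | no ne = ind-⊆ (λ e eq → case assign⁻ {a = a} eq of λ { (inj₁ (_ , p)) → contradiction (just-injective (sym p)) ne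
                                                          ; (inj₂ (_ , q)) → q }) (valid j)

    module _ {X : Fin N → Set} (X? : Decidable X) (a₀ : Assignment N t) (valid₀ : Valid a₀) where

      -- The used set grows by exactly one element. One inclusion keeps an earlier packing in use,
      -- the other keeps the new elements inside `X`.
      Augmentation : Set ℓ
      Augmentation = Σ[ a ∈ Assignment N t ] Σ[ x ∈ Fin N ]
        (Valid a × X x × a₀ x ≡ nothing × (∀ e → Used a₀ e ⊎ e ≡ x → Used a e) × (∀ e → Used a e → Used a₀ e ⊎ e ≡ x))

      displace : Assignment N t → Fin N → Fin t → Fin N → Assignment N t
      displace a x i z = assign (assign a z nothing) x (just i)

      -- Reach a x: starting from some unused element of X, a chain of displacements has led to the
      -- assignment a in which x is the element currently left without a slot.
      data Reach : Assignment N t → Fin N → Set ℓ where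
        start : ∀ {x} → X x → a₀ x ≡ nothing → Reach a₀ x
        move  : ∀ {a x z i} → Reach a x → a z ≡ just i → ¬ cl (Slot a i ⊝ z) x → Reach (displace a x i z) z

      displace⁻ : ∀ {a x i z j e} → Slot (displace a x i z) j e → (e ≡ x × j ≡ i) ⊎ (a e ≡ just j × e ≢ z)
      displace⁻ {a} {x} {i} {z} eq with assign⁻ {a = assign a z nothing} {x} eq
      ... | inj₁ (p , q) = inj₁ (p , just-injective (sym q))
      ... | inj₂ (_ , q) with assign⁻ {a = a} {z} q
      ...   | inj₂ (ne , r) = inj₂ (r , ne)

      -- The invariant of a chain of displacements: the used elements together with the one in hand
      -- remain those of the start.
      Trace : Assignment N t → Fin N → Set
      Trace a x = Σ[ x₀ ∈ Fin N ] (X x₀ × a₀ x₀ ≡ nothing ×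
        (∀ e → Used a₀ e ⊎ e ≡ x₀ → Used a e ⊎ e ≡ x) × (∀ e → Used a e ⊎ e ≡ x → Used a₀ e ⊎ e ≡ x₀))

      reach-invariant : ∀ {a x} → Reach a x → Valid a × a x ≡ nothing × Trace a x
      reach-invariant (start xx un) = valid₀ , un , _ , xx , un , (λ _ → id) , λ _ → id
      reach-invariant (move {a} {x} {z} {i} r az ¬c) with reach-invariant r
      ... | valid , un , x₀ , xx₀ , un₀ , f , g = valid′ , unz , x₀ , xx₀ , un₀ , (λ e → fwd e ∘ f e) , λ e → g e ∘ bwd e
        where
        x≢z : z ≢ x
        x≢z refl = case trans (sym az) un of λ ()
        unz : displace a x i z z ≡ nothing
        unz = trans (assign-≢ x≢z) (assign-≡ a z nothing)
        valid′ : Valid (displace a x i z)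
        valid′ j with j ≟ i
        ... | yes refl = ind-⊆ (λ e eq → case displace⁻ {a} {x} {i} {z} eq of λ { (inj₁ (p , _)) → inj₂ p ; (inj₂ q) → inj₁ q })
                           (ind-⊕ (⊝-dec (slot? a i) z) (ind-⊆ (λ _ → proj₁) (valid i)) ¬c)
        ... | no ne = ind-⊆ (λ e eq → case displace⁻ {a} {x} {i} {z} eq of λ { (inj₁ (_ , p)) → contradiction p ne ; (inj₂ (q , _)) → q }) (valid j)
        fwd : ∀ e → Used a e ⊎ e ≡ x → Used (displace a x i z) e ⊎ e ≡ z
        fwd e (inj₂ refl) = inj₁ (i , assign-≡ _ x (just i))
        fwd e (inj₁ (j , eq)) with e ≟ z | e ≟ x
        ... | yes p | _ = inj₂ p
        ... | no ne | yes refl = inj₁ (i , refl)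
        ... | no ne | no ne′ = inj₁ (j , trans (assign-≢ ne) eq)
        bwd : ∀ e → Used (displace a x i z) e ⊎ e ≡ z → Used a e ⊎ e ≡ x
        bwd e (inj₂ refl) = inj₁ (i , az)
        bwd e (inj₁ (j , eq)) with displace⁻ {a} {x} {i} {z} eq
        ... | inj₁ (p , _) = inj₂ p
        ... | inj₂ (q , _) = inj₁ (j , q)

      -- If no augmentation exists and D is the set of all elements that can be displaced, then each slot
      -- spans D already by its elements in D, because displacements never enlarge the span of (slot ∩ D).
      module _ (¬aug : ¬ Augmentation) (D? : Decidable (λ e → ∃[ a ] Reach a e)) where

        -- `Reach` lives in `Set ℓ`; `True` of its decision is a predicate to which `cl` applies.
        D : Fin N → Set
        D e = True (D? e)

        DSlot : Fin t → Fin N → Set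
        DSlot i e = Slot a₀ i e × D e

        dslot? : ∀ i → Decidable (DSlot i)
        dslot? i e = slot? a₀ i e ×-dec T-dec _

        -- Otherwise `x` could enter slot `i`, and the chain would end in an augmentation.
        stuck : ∀ {a x} → Reach a x → ∀ i → cl (Slot a i) x
        stuck {a} {x} r i with cl? (slot? a i) x | reach-invariant r
        ... | yes c | _ = c
        ... | no ¬c | valid , un , x₀ , xx₀ , un₀ , f , g =
          contradiction (assign a x (just i) , x₀ , assign-valid {a} valid ¬c , xx₀ , un₀ , (λ e → fwd e ∘ f e) , λ e → g e ∘ bwd e) ¬aug
          where
          fwd : ∀ e → Used a e ⊎ e ≡ x → Used (assign a x (just i)) e
          fwd e (inj₂ refl) = i , assign-≡ a x (just i)
          fwd e (inj₁ (j , eq)) with e ≟ x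
          ... | yes refl = i , refl
          ... | no ne = j , eq
          bwd : ∀ e → Used (assign a x (just i)) e → Used a e ⊎ e ≡ x
          bwd e (j , eq) with assign⁻ {a = a} eq
          ... | inj₁ (p , _) = inj₂ p
          ... | inj₂ (_ , q) = inj₁ (j , q)

        -- Each slot element on the fundamental circuit of `x` can be displaced by `x`, hence lies
        -- in `D`.
        span-D : ∀ {a x} → Reach a x → ∀ i → cl (λ e → Slot a i e × D e) x
        span-D {a} r i = circuit (slot? a i) (proj₁ (reach-invariant r) i) (λ _ → T-dec _) (stuck r i)
          λ z az ¬c → fromWitness (_ , move r az ¬c)

        span-invariant : ∀ {a x} → Reach a x → ∀ i e → Slot a i e → D e → cl (DSlot i) e
        span-invariant (start _ _) i e ae de = cl-incl (ae , de)
        span-invariant (move {a} {x} {z} {j} r az ¬c) i e ae de with displace⁻ {a} {x} {j} {z} {i} {e} ae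
        -- The only newcomer to a slot is `x`, entering slot `j`; by `span-D` it was already spanned
        -- by the elements of that slot in `D`.
        ... | inj₁ (refl , refl) = cl-trans (λ e′ → λ { (p , q) → span-invariant r i e′ p q }) (span-D r i)
        ... | inj₂ (p , _) = span-invariant r i e p de

        D⊆cl : ∀ i e → D e → cl (DSlot i) e
        D⊆cl i e de with _ , r ← toWitness de = cl-trans (λ e′ → λ { (p , q) → span-invariant r i e′ p q }) (span-D r i)

        stuck-bound : count (diff? X? (cl? (dslot? slot₀))) + t * count (dslot? slot₀) ≤ count (used? a₀)
        stuck-bound = ≤-trans (+-mono-≤ outside inside)
          (count-disjoint (used? a₀) out? in? (λ _ → proj₁) (λ _ → proj₁) λ { _ (_ , nd) (_ , d) → nd d })
          where
          out? : Decidable (λ e → Used a₀ e × ¬ D e)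
          out? e = used? a₀ e ×-dec ¬? (T-dec _)
          in? : Decidable (λ e → Used a₀ e × D e)
          in? e = used? a₀ e ×-dec T-dec _
          outside : count (diff? X? (cl? (dslot? slot₀))) ≤ count out?
          outside = count-mono _ out? λ e → λ { (xe , ¬c) →
            decidable-stable (used? a₀ e) (λ ¬u → ¬c (D⊆cl slot₀ e (fromWitness (_ , start xe (unused {a = a₀} ¬u))))) ,
            λ d → ¬c (D⊆cl slot₀ e d) }
          inside : t * count (dslot? slot₀) ≤ count in?
          inside = count-disjoint-family in? dslot? (λ { i e (p , d) → (i , p) , d })
            (λ { i j e (p , _) (q , _) → slot-unique {a = a₀} p q })
            λ i → steinitz (dslot? slot₀) (dslot? i) (ind-⊆ (λ _ → proj₁) (valid₀ slot₀)) λ { e (_ , d) → D⊆cl i e d }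

      augment : (∀ {V} (V? : Decidable V) → Ind V → count (used? a₀) < count (diff? X? (cl? V?)) + t * count V?) →
        ¬ ¬ Augmentation
      augment big ¬aug = ¬¬-∀ (λ e → ¬¬-excluded-middle) λ D? →
        <⇒≱ (big (dslot? ¬aug D? slot₀) (ind-⊆ (λ _ → proj₁) (valid₀ slot₀))) (stuck-bound ¬aug D?)

    -- Matroid union: `cl V` ranges over the flats and `count V?` is their rank, so the hypothesis
    -- is the union bound for `X`. The start is an arbitrary valid `a`, so that one packing can
    -- extend another; `fuel` bounds the number of augmentations still needed.
    pack : ∀ {X} (X? : Decidable X) n → (∀ {V} (V? : Decidable V) → Ind V → n ≤ count (diff? X? (cl? V?)) + t * count V?) →
      ∀ fuel a → Valid a → n ≤ count (used? a) + fuel →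
      ¬ ¬ (Σ[ b ∈ Assignment N t ] (Valid b × n ≤ count (used? b) × (∀ e → Used a e → Used b e) × (∀ e → Used b e → Used a e ⊎ X e)))
    pack X? n big zero a valid le k = k (a , valid , subst (n ≤_) (+-identityʳ _) le , (λ _ → id) , λ _ → inj₁)
    pack X? n big (suc fuel) a valid le k with n ≤? count (used? a)
    ... | yes done = k (a , valid , done , (λ _ → id) , λ _ → inj₁)
    ... | no more = augment X? a valid (λ V? ind → <-≤-trans (≰⇒> more) (big V? ind)) λ
      { (b , x , validb , xx , un , up , down) →
        pack X? n big fuel b validb
          (≤-trans le (≤-trans (≤-reflexive (+-suc _ fuel)) (+-monoˡ-≤ fuel
            (count-extend (used? a) (used? b) x (λ e u → up e (inj₁ u)) (up x (inj₂ refl))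
              λ { (i , eq) → case trans (sym eq) un of λ () }))))
          λ { (c , validc , done , b⊆c , c⊆) → k (c , validc , done , (λ e u → b⊆c e (up e (inj₁ u))) ,
                λ e uc → [ (λ ub → [ inj₁ , (λ { refl → inj₂ xx }) ]′ (down e ub)) , inj₂ ]′ (c⊆ e uc)) } }

  -- Exchanges that make disjoint bases rainbow

  count-image : ∀ {n m p} {P : Fin n → Set p} (P? : Decidable P) (f : Fin n → Fin m)
    {C : Fin m → Set p} (C? : Decidable C) → (∀ c → C c → ∃[ e ] (P e × f e ≡ c)) → count C? ≤ count P?
  count-image P? f C? pre = injective⇒≤ {f = λ i → index P? _ (proj₁ (proj₂ (pre′ i)))} λ {i} {j} eq →
    enum-injective C? (trans (sym (proj₂ (proj₂ (pre′ i))))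
      (trans (cong f (trans (sym (enum-index P? _ _)) (trans (cong (enum P?) eq) (enum-index P? _ _)))) (proj₂ (proj₂ (pre′ j)))))
    where
    pre′ : ∀ i → _
    pre′ i = pre (enum C? i) (enum-∈ C? i)

  sumℕ-tight : ∀ {t d} (f : Fin t → ℕ) → (∀ i → f i ≤ d) → t * d ≤ sumℕ f → ∀ i → d ≤ f i
  sumℕ-tight {t} {d} f ub lb i with d ≤? f i
  ... | yes le = le
  ... | no nle = contradiction lb (<⇒≱ (subst (sumℕ f <_) (sumℕ-const t d) (sumℕ-strict ub i (≰⇒> nle))))

  module Rainbow {N ℓ} (M : Matroid N ℓ) {t : ℕ} (slot₀ : Fin t) {m : ℕ} (col : Fin N → Fin m) (d : ℕ)
    (rank≤ : ∀ {V} (V? : Decidable V) → Matroid.Ind M V → count V? ≤ suc d) where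
    open Matroid M
    open Packing M slot₀

    Sees : Assignment N t → Fin t → Fin m → Set
    Sees a i c = ∃[ e ] (Slot a i e × col e ≡ c)

    sees? : ∀ a i → Decidable (Sees a i)
    sees? a i c = any? λ e → slot? a i e ×-dec (col e ≟ c)

    sees≤ : ∀ {a} → Valid a → ∀ i → count (sees? a i) ≤ suc d
    sees≤ {a} valid i = ≤-trans (count-image (slot? a i) col (sees? a i) λ _ → id) (rank≤ (slot? a i) (valid i))

    Colours : Assignment N t → Fin m → Set
    Colours a c = ∃[ e ] (Used a e × col e ≡ c)

    colours? : ∀ a → Decidable (Colours a)
    colours? a c = any? λ e → used? a e ×-dec (col e ≟ c)

    -- The rank is at most `suc d`, so using `t * suc d` elements makes every slot a basis. The
    -- bound on the colours prevents the slots linked to a non-rainbow one from being all slots.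
    Packed : Assignment N t → Set ℓ
    Packed a = Valid a × t * suc d ≤ count (used? a) × suc (t * d) ≤ count (colours? a)

    Rainbow : Assignment N t → Set
    Rainbow a = ∀ x y i → Slot a i x → Slot a i y → col x ≡ col y → x ≡ y

    slot-full : ∀ {a} → Packed a → ∀ i → suc d ≤ count (slot? a i)
    slot-full {a} (valid , full , _) = sumℕ-tight (λ i → count (slot? a i)) (λ i → rank≤ (slot? a i) (valid i))
      (≤-trans full (count-cover-family (used? a) (slot? a) λ _ → id))

    slot-spans : ∀ {a} → Packed a → ∀ i x → cl (Slot a i) x
    slot-spans {a} packed@(valid , _) i x with cl? (slot? a i) x
    ... | yes c = c
    ... | no ¬c = contradiction (rank≤ (⊕-dec (slot? a i) x) (ind-⊕ (slot? a i) (valid i) ¬c))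
      (<⇒≱ (≤-trans (s≤s (slot-full packed i))
        (count-extend (slot? a i) (⊕-dec (slot? a i) x) x (λ _ → inj₁) (inj₂ refl) (¬c ∘ cl-incl))))

    module _ {a} (packed : Packed a) where
      private valid = proj₁ packed

      Shares : (Fin t → Set) → Fin m → Set
      Shares I c = ∃[ i ] (I i × Sees a i c)

      shares? : ∀ {I} → Decidable I → Decidable (Shares I)
      shares? I? c = any? λ i → I? i ×-dec sees? a i c

      ClosedAround : Fin t → Set₁
      ClosedAround i₀ = Σ[ I ∈ (Fin t → Set) ] Σ[ j ∈ Fin t ] (I i₀ × ¬ I j × (∀ c → Sees a j c → ¬ Shares I c))

      -- A set I of slots linked through common colours sees at most |I|·d colours once one of its slots
      -- is not rainbow, so it cannot exhaust all slots.
      grow : ∀ i₀ fuel {I} (I? : Decidable I) → t ≤ count I? + fuel → I i₀ → count (shares? I?) ≤ count I? * d → ClosedAround i₀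
      grow i₀ fuel {I} I? le Ii₀ few with any? (λ j → ¬? (I? j) ×-dec any? λ c → sees? a j c ×-dec shares? I? c)
      ... | no none with any? (λ j → ¬? (I? j))
      ...   | yes (j , ¬Ij) = I , j , Ii₀ , ¬Ij , λ c s s′ → none (j , ¬Ij , c , s , s′)
      -- If `I` contained every slot, the packing would have at most `t * d` colours.
      ...   | no all = contradiction (≤-trans (proj₂ (proj₂ packed)) (≤-trans (count-mono (colours? a) (shares? I?) within)
                (≤-trans few (*-monoˡ-≤ d (count≤n I?))))) (<-irrefl refl)
        where
        within : ∀ c → Colours a c → Shares I c
        within c (e , (i , ae) , eq) = i , decidable-stable (I? i) (λ ¬Ii → all (i , ¬Ii)) , e , ae , eq
      grow i₀ zero {I} I? le Ii₀ few | yes (j , ¬Ij , _) =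
        contradiction (≤-trans (count-extend I? (⊕-dec I? j) j (λ _ → inj₁) (inj₂ refl) ¬Ij) (count≤n (⊕-dec I? j)))
          (≤⇒≯ (≤-trans le (≤-reflexive (+-identityʳ _))))
      grow i₀ (suc fuel) {I} I? le Ii₀ few | yes (j , ¬Ij , c , s , s′) = grow i₀ fuel I′? le′ (inj₁ Ii₀) few′
        where
        I′? = ⊕-dec I? j
        more : suc (count I?) ≤ count I′?
        more = count-extend I? I′? j (λ _ → inj₁) (inj₂ refl) ¬Ij
        le′ : t ≤ count I′? + fuel
        le′ = ≤-trans le (≤-trans (≤-reflexive (+-suc _ fuel)) (+-monoˡ-≤ fuel more))
        split : ∀ c′ → Shares (I ⊕ j) c′ → (Sees a j ⊝ c) c′ ⊎ Shares I c′
        split c′ (i , inj₁ Ii , si) = inj₂ (i , Ii , si)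
        split c′ (i , inj₂ refl , si) with c′ ≟ c
        ... | yes refl = inj₂ s′
        ... | no ne = inj₁ (si , ne)
        -- Slot `j` shares the colour `c` with the slots in `I`, so it contributes at most `d` new
        -- colours.
        few′ : count (shares? I′?) ≤ count I′? * d
        few′ = begin
          count (shares? I′?)                                      ≤⟨ count-cover (shares? I′?) (⊝-dec (sees? a j) c) (shares? I?) split ⟩
          count (⊝-dec (sees? a j) c) + count (shares? I?)  ≤⟨ +-mono-≤ (≤-pred (≤-trans
              (count-extend (⊝-dec (sees? a j) c) (sees? a j) c (λ _ → proj₁) s λ { (_ , ne) → ne refl }) (sees≤ {a} valid j))) few ⟩
          d + count I? * d                                         ≤⟨ *-monoˡ-≤ d more ⟩
          count I′? * d                                            ∎
          where open ≤-Reasoning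

      -- The growth starts from slot `i₀` alone. It sees at most `d` colours, since dropping `x`
      -- from its at most `suc d` elements loses no colour.
      closed : ∀ {i₀ x y} → Slot a i₀ x → Slot a i₀ y → x ≢ y → col x ≡ col y → ClosedAround i₀
      closed {i₀} {x} {y} ax ay x≢y cxy = grow i₀ t (_≟ i₀) (m≤n+m t _) refl (begin
        count (shares? (_≟ i₀))        ≤⟨ count-image (⊝-dec (slot? a i₀) x) col (shares? (_≟ i₀)) witness ⟩
        count (⊝-dec (slot? a i₀) x)   ≤⟨ ≤-pred (≤-trans (count-extend (⊝-dec (slot? a i₀) x) (slot? a i₀) x (λ _ → proj₁) ax
                                             λ { (_ , ne) → ne refl }) (rank≤ (slot? a i₀) (valid i₀))) ⟩
        d                              ≡⟨ *-identityˡ d ⟨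
        1 * d                          ≤⟨ *-monoˡ-≤ d (count-positive (_≟ i₀) refl) ⟩
        count (_≟ i₀) * d              ∎)
        where
        open ≤-Reasoning
        witness : ∀ c → Shares (_≡ i₀) c → ∃[ e ] ((Slot a i₀ ⊝ x) e × col e ≡ c)
        witness c (_ , refl , e , ae , eq) with e ≟ x
        ... | yes refl = y , (ay , x≢y ∘ sym) , trans (sym cxy) eq
        ... | no ne = e , (ae , ne) , eq

    diversity : Assignment N t → ℕ
    diversity b = sumℕ λ i → count (sees? b i)

    -- Swapping one of two equally coloured elements x, y of slot i₀ for an element u of a slot j that shares
    -- no colour with slot i₀ adds a colour to slot i₀ and does not decrease the number of colours of slot j.
    module Swap {a} (packed : Packed a) {i₀ j x y u} (ax : Slot a i₀ x) (ay : Slot a i₀ y) (x≢y : x ≢ y) (cxy : col x ≡ col y)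
      (i₀≢j : i₀ ≢ j) (apart : ∀ c → Sees a j c → ¬ Sees a i₀ c)
      (au : Slot a j u) (¬c : ¬ cl (Slot a i₀ ⊝ x) u) (¬c′ : ¬ cl (Slot a j ⊝ u) x) where

      private valid = proj₁ packed

      b : Assignment N t
      b = assign (assign a x (just j)) u (just i₀)
      x≢u : x ≢ u
      x≢u refl = i₀≢j (slot-unique {a = a} ax au)
      bu : b u ≡ just i₀
      bu = assign-≡ _ u (just i₀)
      bx : b x ≡ just j
      bx = trans (assign-≢ x≢u) (assign-≡ a x (just j))
      b-other : ∀ {e} → e ≢ x → e ≢ u → b e ≡ a e
      b-other e≢x e≢u = trans (assign-≢ e≢u) (assign-≢ e≢x)
      b⁻ : ∀ {l e} → Slot b l e → (e ≡ u × l ≡ i₀) ⊎ (e ≡ x × l ≡ j) ⊎ (Slot a l e × e ≢ x × e ≢ u)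
      b⁻ eq with assign⁻ {a = assign a x (just j)} {u} eq
      ... | inj₁ (p , q) = inj₁ (p , just-injective (sym q))
      ... | inj₂ (ne , q) with assign⁻ {a = a} {x} q
      ...   | inj₁ (p , r) = inj₂ (inj₁ (p , just-injective (sym r)))
      ...   | inj₂ (ne′ , r) = inj₂ (inj₂ (r , ne′ , ne))
      valid′ : Valid b
      valid′ l with l ≟ i₀ | l ≟ j
      ... | yes refl | _ = ind-⊆ (λ e eq → case b⁻ eq of λ { (inj₁ (p , _)) → inj₂ p ; (inj₂ (inj₁ (_ , p))) → contradiction p i₀≢j
                                                         ; (inj₂ (inj₂ (p , ne , _))) → inj₁ (p , ne) })
                             (ind-⊕ (⊝-dec (slot? a i₀) x) (ind-⊆ (λ _ → proj₁) (valid i₀)) ¬c)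
      ... | no ne | yes refl = ind-⊆ (λ e eq → case b⁻ eq of λ { (inj₁ (_ , p)) → contradiction p ne ; (inj₂ (inj₁ (p , _))) → inj₂ p
                                                         ; (inj₂ (inj₂ (p , _ , ne′))) → inj₁ (p , ne′) })
                             (ind-⊕ (⊝-dec (slot? a j) u) (ind-⊆ (λ _ → proj₁) (valid j)) ¬c′)
      ... | no ne | no ne′ = ind-⊆ (λ e eq → case b⁻ eq of λ { (inj₁ (_ , p)) → contradiction p ne
                                                         ; (inj₂ (inj₁ (_ , p))) → contradiction p ne′
                                                         ; (inj₂ (inj₂ (p , _))) → p }) (valid l)
      used′ : ∀ e → Used a e → Used b e
      used′ e (l , ae) with e ≟ x
      ... | yes refl = j , bx
      ... | no e≢x with e ≟ u
      ...   | yes refl = i₀ , refl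
      ...   | no e≢u = l , trans (assign-≢ e≢x) ae
      keep : ∀ l c → l ≢ j → Sees a l c → Sees b l c
      keep l c l≢j (e , ae , eq) with e ≟ x
      ... | no e≢x = e , trans (b-other e≢x λ { refl → l≢j (slot-unique {a = a} ae au) }) ae , eq
      -- The element lost is `x`, and `y` stays in the slot with the same colour.
      ... | yes refl = y , trans (b-other (x≢y ∘ sym) λ { refl → i₀≢j (slot-unique {a = a} ay au) })
                             (trans ay (trans (sym ax) ae)) , trans (sym cxy) eq
      mono : ∀ l → count (sees? a l) ≤ count (sees? b l)
      mono l with l ≟ j
      ... | no ne = count-mono (sees? a l) (sees? b l) λ c → keep l c ne
      -- Slot `j` loses at most the colour of `u` and gains that of `x`, which it did not see
      -- because it shares no colour with slot `i₀`.
      ... | yes refl = ≤-trans (count-⊝ (sees? a j) (col u))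
        (count-extend (⊝-dec (sees? a j) (col u)) (sees? b j) (col x)
          (λ { c ((e , ae , eq) , ne) → e , trans (b-other (λ { refl → i₀≢j (slot-unique {a = a} ax ae) })
                                              λ { refl → ne (sym eq) }) ae , eq })
          (x , bx , refl) λ { (s , _) → apart (col x) s (x , ax , refl) })

      packed′ : Packed b
      packed′ = valid′ , ≤-trans (proj₁ (proj₂ packed)) (count-mono (used? a) (used? b) used′) ,
        ≤-trans (proj₂ (proj₂ packed)) (count-mono (colours? a) (colours? b) λ { c (e , ue , eq) → e , used′ e ue , eq })

      more-diverse : diversity a < diversity b
      more-diverse = sumℕ-strict mono i₀ (count-extend (sees? a i₀) (sees? b i₀) (col u) (λ c → keep i₀ c i₀≢j) (u , bu , refl)
        (apart (col u) (u , au , refl)))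

    Clash : Assignment N t → Set
    Clash a = ∃[ i ] ∃[ x ] ∃[ y ] (Slot a i x × Slot a i y × x ≢ y × col x ≡ col y)

    clash? : ∀ a → Dec (Clash a)
    clash? a = any? λ i → any? λ x → any? λ y → slot? a i x ×-dec slot? a i y ×-dec ¬? (x ≟ y) ×-dec (col x ≟ col y)

    Improvement : Assignment N t → Set ℓ
    Improvement a = Σ[ b ∈ Assignment N t ] (Packed b × diversity a < diversity b)

    abstract
      improve : ∀ {a} → Packed a → Clash a → Improvement a
      improve {a} packed@(valid , _) (i₀ , x , y , ax , ay , x≢y , cxy) = between (closed packed ax ay x≢y cxy)
        where
        between : ClosedAround packed i₀ → Improvement a
        between (I , j , Ii₀ , ¬Ij , apart) =
          swap (symmetric-exchange (slot? a i₀) (slot? a j) (valid i₀) (valid j) ax (slot-spans packed j x))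
          where
          swap : ∃[ u ] (Slot a j u × ¬ cl (Slot a i₀ ⊝ x) u × ¬ cl (Slot a j ⊝ u) x) → Improvement a
          swap (u , au , ¬c , ¬c′) = S.b , S.packed′ , S.more-diverse
            where
            module S = Swap packed ax ay x≢y cxy (λ eq → ¬Ij (subst I eq Ii₀)) (λ c s s′ → apart c s (i₀ , Ii₀ , s′)) au ¬c ¬c′

    -- `diversity` grows with every improvement and never exceeds `t * m`, so the fuel cannot run
    -- out while clashes remain.
    rainbow : ∀ fuel {a} → Packed a → t * m ≤ diversity a + fuel → Σ[ b ∈ Assignment N t ] (Packed b × Rainbow b)
    rainbow fuel {a} packed le with clash? a
    ... | no none = a , packed , λ x y i ax ay eq → decidable-stable (x ≟ y) λ ne → none (i , x , y , ax , ay , ne , eq)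
    ... | yes clash = next fuel le (improve packed clash)
      where
      next : ∀ fuel → t * m ≤ diversity a + fuel → Improvement a → Σ[ b ∈ Assignment N t ] (Packed b × Rainbow b)
      next zero le (b , packed′ , lt) =
        contradiction (≤-trans lt (≤-trans (sumℕ-mono λ i → count≤n (sees? b i)) (≤-reflexive (sumℕ-const t m))))
          (≤⇒≯ (≤-trans le (≤-reflexive (+-identityʳ _))))
      next (suc fuel) le (b , packed′ , lt) =
        rainbow fuel packed′ (≤-trans le (≤-trans (≤-reflexive (+-suc _ fuel)) (+-monoˡ-≤ fuel lt)))

  -- Disjoint rainbow bases from many colours

  count-split : ∀ {n p q} {P : Fin n → Set p} {Q : Fin n → Set q} (P? : Decidable P) (Q? : Decidable Q) →
    count P? ≤ count (diff? P? Q?) + count Q?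
  count-split {P = P} {Q} P? Q? = count-cover P? (diff? P? Q?) Q? split
    where
    split : ∀ i → P i → (P i × ¬ Q i) ⊎ Q i
    split i pi with Q? i
    ... | yes qi = inj₂ qi
    ... | no ¬qi = inj₁ (pi , ¬qi)

  -- The rank is at most `suc d`, and `g r` bounds the size of a flat of rank `r`. `g-N` gives the
  -- union bound for `t` disjoint bases, `g-m` the one for packing `suc (t * d)` colour
  -- representatives, in ranks below `d`; by `g-hyperplane` flats of rank `d` are proper.
  module AntiRamsey {N ℓ} (M : Matroid N ℓ) {t : ℕ} (slot₀ : Fin t) {m : ℕ} (col : Fin N → Fin m) (d : ℕ) (g : ℕ → ℕ)
    (rank≤ : ∀ {V} (V? : Decidable V) → Matroid.Ind M V → count V? ≤ suc d)
    (flat≤ : ∀ {V} (V? : Decidable V) → Matroid.Ind M V → count (Matroid.cl? M V?) ≤ g (count V?))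
    (g-N : ∀ r → r ≤ suc d → g r + t * suc d ≤ N + t * r)
    (g-m : ∀ r → r < d → g r + suc (t * d) ≤ m + t * r)
    (g-hyperplane : g d < N) where

    open Matroid M
    open Packing M slot₀
    open Rainbow M slot₀ col d rank≤

    Section : Set
    Section = Σ[ s ∈ (Fin m → Fin N) ] (∀ c → col (s c) ≡ c)

    -- The image of `s`, written so that membership is a single equality test.
    Transversal : Section → Fin N → Set
    Transversal (s , _) e = s (col e) ≡ e

    transversal? : ∀ σ → Decidable (Transversal σ)
    transversal? (s , _) e = s (col e) ≟ e

    t*-mono-< : ∀ {r q} → r < q → t * r < t * q
    t*-mono-< = *-monoʳ-< t {{>-nonZero (≤-trans (s≤s z≤n) (toℕ<n slot₀))}}

    outside-flat : ∀ {P : Fin N → Set} (P? : Decidable P) {V} (V? : Decidable V) → Ind V → ∀ b q → b ≤ count P? →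
      g (count V?) + q ≤ b + t * count V? → q ≤ count (diff? P? (cl? V?)) + t * count V?
    outside-flat P? V? ind b q b≤ le = +-cancelˡ-≤ (g r) q _ (begin
      g r + q                        ≤⟨ le ⟩
      b + t * r                      ≤⟨ +-monoˡ-≤ (t * r) b≤ ⟩
      count P? + t * r               ≤⟨ +-monoˡ-≤ (t * r) (count-split P? (cl? V?)) ⟩
      (o + count (cl? V?)) + t * r   ≤⟨ +-monoˡ-≤ (t * r) (+-monoʳ-≤ o (flat≤ V? ind)) ⟩
      (o + g r) + t * r              ≡⟨ cong (_+ t * r) (+-comm o (g r)) ⟩
      (g r + o) + t * r              ≡⟨ +-assoc (g r) o (t * r) ⟩
      g r + (o + t * r)              ∎)
      where
      open ≤-Reasoning
      r = count V?
      o = count (diff? P? (cl? V?))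

    Wide : Section → Set _
    Wide σ = ∀ {V} (V? : Decidable V) → Ind V → suc (t * d) ≤ count (diff? (transversal? σ) (cl? V?)) + t * count V?

    low-rank : ∀ σ {V} (V? : Decidable V) → Ind V → count V? < d →
      suc (t * d) ≤ count (diff? (transversal? σ) (cl? V?)) + t * count V?
    low-rank σ@(s , sec) V? ind lt = outside-flat (transversal? σ) V? ind m (suc (t * d))
      (injection⇒≤count (transversal? σ) s (λ {c} {c′} eq → trans (sym (sec c)) (trans (cong col eq) (sec c′))) (λ c → cong s (sec c)))
      (g-m _ lt)

    -- In rank below `d`, `low-rank` would leave at least `t + 1` transversal points outside.
    -- Allowing one missed point makes this applicable after a representative is removed.
    rank≥d : ∀ σ {V} (V? : Decidable V) → Ind V → count (diff? (transversal? σ) (cl? V?)) ≤ 1 → d ≤ count V?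
    rank≥d σ V? ind few = ≮⇒≥ λ lt → <⇒≱ (t*-mono-< lt)
      (≤-pred (≤-trans (low-rank σ V? ind lt) (+-monoˡ-≤ (t * count V?) few)))

    -- Rank below `d` is `low-rank`, and above `d` the term `t * count V?` suffices. In rank `d` one
    -- transversal point outside is enough, and it exists because `W` has more than `d` independent
    -- elements.
    spanning⇒wide : ∀ σ {W} (W? : Decidable W) → Ind W → (∀ e → W e → Transversal σ e) → d < count W? → Wide σ
    spanning⇒wide σ W? indW W⊆ big V? ind with <-cmp (count V?) d
    ... | tri< lt _ _ = low-rank σ V? ind lt
    ... | tri> _ _ gt = ≤-trans (t*-mono-< gt) (m≤n+m _ _)
    ... | tri≈ _ eq _ with any? (diff? (transversal? σ) (cl? V?))
    ...   | yes (_ , x∈) = +-mono-≤ (count-positive (diff? (transversal? σ) (cl? V?)) x∈) (≤-reflexive (cong (t *_) (sym eq)))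
    ...   | no none = contradiction (steinitz W? V? indW λ e we → decidable-stable (cl? V? e) λ nc → none (e , W⊆ e we , nc))
                        (<⇒≱ (subst (_< count W?) (sym eq) big))

    -- If the representatives span only a hyperplane, some `e` outside it replaces the
    -- representative of its colour. By `rank≥d` the others still have rank `d`, so together with
    -- `e` they span.
    wide-section : Section → Σ[ σ ∈ Section ] Wide σ
    wide-section σ@(s , sec) with W , W? , indW , W⊆ , spW ← basis (transversal? σ) | suc d ≤? count W?
    ... | yes big = σ , spanning⇒wide σ W? indW W⊆ big
    ... | no small = σ′ , spanning⇒wide σ′ (⊕-dec W₁? e) (ind-⊕ W₁? indW₁ ¬clW₁) W₁⊕e⊆ (≤-trans (s≤s d≤W₁)
            (count-extend W₁? (⊕-dec W₁? e) e (λ _ → inj₁) (inj₂ refl) (¬clW₁ ∘ cl-incl)))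
      where
      W≡d : count W? ≡ d
      W≡d = ≤-antisym (≤-pred (≰⇒> small)) (rank≥d σ W? indW
        (≤-trans (≤-reflexive (count-none (diff? (transversal? σ) (cl? W?)) λ { e (te , nc) → nc (spW e te) })) z≤n))
      new : ∃[ e ] ¬ cl W e
      new with any? (λ e → ¬? (cl? W? e))
      ... | yes found = found
      ... | no none = contradiction (≤-trans (count-all (cl? W?) λ e → decidable-stable (cl? W? e) λ nc → none (e , nc))
              (≤-trans (flat≤ W? indW) (≤-reflexive (cong g W≡d)))) (<⇒≱ g-hyperplane)
      e = proj₁ new
      s′ : Fin m → Fin N
      s′ c with c ≟ col e
      ... | yes _ = e
      ... | no _ = s c
      sec′ : ∀ c → col (s′ c) ≡ c
      sec′ c with c ≟ col e
      ... | yes eq = sym eq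
      ... | no _ = sec c
      σ′ : Section
      σ′ = s′ , sec′
      rest? = ⊝-dec (transversal? σ) (s (col e))
      basis₁ = basis rest?
      W₁ = proj₁ basis₁
      W₁? = proj₁ (proj₂ basis₁)
      indW₁ = proj₁ (proj₂ (proj₂ basis₁))
      W₁⊆ = proj₁ (proj₂ (proj₂ (proj₂ basis₁)))
      spW₁ = proj₂ (proj₂ (proj₂ (proj₂ basis₁)))
      ¬clW₁ : ¬ cl W₁ e
      ¬clW₁ c = proj₂ new (cl-trans (λ w w∈ → spW w (proj₁ (W₁⊆ w w∈))) c)
      d≤W₁ : d ≤ count W₁?
      d≤W₁ = rank≥d σ W₁? indW₁ (≤-trans (count-mono (diff? (transversal? σ) (cl? W₁?)) (_≟ s (col e))
        λ x → λ { (tx , nc) → decidable-stable (x ≟ s (col e)) λ ne → nc (spW₁ x (tx , ne)) }) (count-singleton (s (col e))))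
      W₁⊕e⊆ : ∀ x → (W₁ ⊕ e) x → s′ (col x) ≡ x
      W₁⊕e⊆ x (inj₂ refl) with col e ≟ col e
      ... | yes _ = refl
      ... | no ne = contradiction refl ne
      W₁⊕e⊆ x (inj₁ wx) with col x ≟ col e
      ... | yes eq = contradiction (trans (sym (proj₁ (W₁⊆ x wx))) (cong s eq)) (proj₂ (W₁⊆ x wx))
      ... | no _ = proj₁ (W₁⊆ x wx)

    -- First `suc (t * d)` elements of a transversal are packed, then the packing is filled up to
    -- `t` bases from all elements. The second phase keeps the elements of the first in use, so
    -- their distinct colours survive.
    disjoint-rainbow-bases : Section → ¬ ¬ (Σ[ a ∈ Assignment N t ]
      (Valid a × (∀ i → suc d ≤ count (slot? a i)) × Rainbow a))
    disjoint-rainbow-bases σ₀ k = partial (wide-section σ₀)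
      where
      all? : Decidable {A = Fin N} (λ _ → ⊤)
      all? _ = yes tt
      empty : Assignment N t
      empty _ = nothing
      finish : ∀ {c} → Packed c → ⊥
      finish {c} packed with a , packed′@(valid , _) , rb ← rainbow (t * m) {c} packed (m≤n+m _ _) =
        k (a , valid , slot-full packed′ , rb)
      partial : Σ[ σ ∈ Section ] Wide σ → ⊥
      partial (σ@(s , sec) , wide) = pack (transversal? σ) (suc (t * d)) wide (suc (t * d)) empty (λ _ _ ()) (m≤n+m _ _) λ
        { (b , validb , fullb , _ , b⊆) →
          pack all? (t * suc d) (λ V? ind → outside-flat all? V? ind N (t * suc d) (count-all all? (λ _ → tt)) (g-N _ (rank≤ V? ind)))
            (t * suc d) b validb (m≤n+m _ _) λ
            { (c , validc , fullc , b⊆c , _) → finish {c} (validc , fullc ,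
                ≤-trans fullb (injection⇒≤count (colours? c) (λ i → col (enum (used? b) i))
                  (λ {i} {j} eq → enum-injective (used? b) (trans (sym (onto b b⊆ i)) (trans (cong s eq) (onto b b⊆ j))))
                  λ i → _ , b⊆c _ (enum-∈ (used? b) i) , refl)) } }
        where
        onto : ∀ b → (∀ e → Used b e → Used empty e ⊎ Transversal σ e) → ∀ i → s (col (enum (used? b) i)) ≡ enum (used? b) i
        onto b b⊆ i with b⊆ _ (enum-∈ (used? b) i)
        ... | inj₂ tr = tr
        ... | inj₁ (_ , ())

open Combinatorics

-- Linear algebra over a field whose equality need not be decidable

module Linear {c ℓ : Level} (F : Field c ℓ) where

  open import Data.Nat.Properties using (m≤n⇒m≤1+n; ≤-trans; ^-monoʳ-≤)
  open Field F hiding (zero)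
  open import Algebra.Properties.Semiring.Sum semiring
  open import Algebra.Properties.Ring ring using (-‿distribˡ-*; -‿distribʳ-*; -‿involutive; x∙y⁻¹≈ε⇒x≈y; -1*x≈-x)
  import Relation.Binary.Reasoning.Setoid setoid as ≈-Reasoning

  ∑≡sum : ∀ {n} (f : Fin n → Carrier) → ∑ F n f ≡ sum f
  ∑≡sum {zero} f = ≡.refl
  ∑≡sum {suc n} f = ≡.cong (f zero +_) (∑≡sum (f ∘ suc))

  sum-zero : ∀ {n} (f : Fin n → Carrier) → (∀ i → f i ≈ 0#) → sum f ≈ 0#
  sum-zero {n} f h = trans (sum-cong-≋ h) (sum-replicate-zero n)

  comb : ∀ {n d} → (Fin n → Carrier) → (Fin n → Fin d → Carrier) → Fin d → Carrier
  comb a v l = sum λ i → a i * v i l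

  comb-zero : ∀ {n d} (a : Fin n → Carrier) (v : Fin n → Fin d → Carrier) l → (∀ i → a i ≈ 0#) → comb a v l ≈ 0#
  comb-zero a v l h = sum-zero (λ i → a i * v i l) λ i → trans (*-congʳ (h i)) (zeroˡ (v i l))

  comb-insertAt : ∀ {n d} (a : Fin n → Carrier) p (v : Fin (suc n) → Fin d → Carrier) l →
    comb (insertAt a p 0#) v l ≈ comb a (v ∘ punchIn p) l
  comb-insertAt a p v l = trans (sum-remove {i = p} (λ i → insertAt a p 0# i * v i l))
    (trans (+-cong (trans (*-congʳ (reflexive (insertAt-lookup a p 0#))) (zeroˡ (v p l)))
      (sum-cong-≋ λ i → *-congʳ {v (punchIn p i) l} (reflexive (insertAt-punchIn a p 0# i)))) (+-identityˡ _))

  δ : ∀ {n} → Fin n → Carrier → Fin n → Carrier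
  δ zero    b zero    = b
  δ zero    b (suc j) = 0#
  δ (suc i) b zero    = 0#
  δ (suc i) b (suc j) = δ i b j

  comb-δ : ∀ {n d} i b (v : Fin n → Fin d → Carrier) l → comb (δ i b) v l ≈ b * v i l
  comb-δ zero b v l = trans (+-congˡ (comb-zero (λ _ → 0#) (v ∘ suc) l λ _ → refl)) (+-identityʳ _)
  comb-δ (suc i) b v l = trans (+-congʳ (zeroˡ _)) (trans (+-identityˡ _) (comb-δ i b (v ∘ suc) l))

  cancel-≉0 : ∀ {x y} → ¬ y ≈ 0# → x * y ≈ 0# → x ≈ 0#
  cancel-≉0 {x} {y} y≉0 xy≈0 with y⁻¹ , yy⁻¹≈1 ← inverse y y≉0 = begin
    x                ≈⟨ *-identityʳ x ⟨
    x * 1#           ≈⟨ *-congˡ yy⁻¹≈1 ⟨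
    x * (y * y⁻¹)    ≈⟨ *-assoc x y y⁻¹ ⟨
    (x * y) * y⁻¹    ≈⟨ *-congʳ xy≈0 ⟩
    0# * y⁻¹         ≈⟨ zeroˡ y⁻¹ ⟩
    0#               ∎
    where open ≈-Reasoning

  -- A positive form of dependence: a nonzero coefficient is named, so that it can be inverted.
  Dependent : ∀ {n d} → (Fin n → Fin d → Carrier) → Set (c ⊔ ℓ)
  Dependent {n} v = Σ[ a ∈ (Fin n → Carrier) ] Σ[ i ∈ Fin n ] (¬ a i ≈ 0# × ∀ l → comb a v l ≈ 0#)

  Independent : ∀ {n d} → (Fin n → Fin d → Carrier) → Set (c ⊔ ℓ)
  Independent {n} v = ∀ a → (∀ l → comb a v l ≈ 0#) → ∀ i → a i ≈ 0#

  independent⇒LI : ∀ {n d} (v : Fin n → Fin d → Carrier) → Independent v → LinearlyIndependent F d n v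
  independent⇒LI v ind a h = ind a λ l → trans (reflexive (≡.sym (∑≡sum λ i → a i * v i l))) (h l)

  LI⇒independent : ∀ {n d} (v : Fin n → Fin d → Carrier) → LinearlyIndependent F d n v → Independent v
  LI⇒independent v li a h = li a λ l → trans (reflexive (∑≡sum λ i → a i * v i l)) (h l)

  -- One step of Gaussian elimination with pivot v p zero; q is chosen such that full p vanishes.
  module Eliminate {n d} (v : Fin (suc n) → Fin (suc d) → Carrier) (p : Fin (suc n)) (pivot : ¬ v p zero ≈ 0#) where

    private
      y = proj₁ (inverse (v p zero) pivot)
      q : Fin d → Carrier
      q l = - (y * v p (suc l))

    full : Fin (suc n) → Fin d → Carrier
    full i l = v i (suc l) + v i zero * q l

    reduced : Fin n → Fin d → Carrier
    reduced = full ∘ punchIn p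

    full-p : ∀ l → full p l ≈ 0#
    full-p l = begin
      v p (suc l) + v p zero * - (y * v p (suc l))      ≈⟨ +-congˡ (-‿distribʳ-* _ _) ⟨
      v p (suc l) + - (v p zero * (y * v p (suc l)))    ≈⟨ +-congˡ (-‿cong (*-assoc _ _ _)) ⟨
      v p (suc l) + - ((v p zero * y) * v p (suc l))    ≈⟨ +-congˡ (-‿cong (*-congʳ (proj₂ (inverse (v p zero) pivot)))) ⟩
      v p (suc l) + - (1# * v p (suc l))                ≈⟨ +-congˡ (-‿cong (*-identityˡ _)) ⟩
      v p (suc l) + - v p (suc l)                       ≈⟨ -‿inverseʳ _ ⟩
      0#                                                ∎
      where open ≈-Reasoning

    comb-reduced : ∀ a l → comb (a ∘ punchIn p) reduced l ≈ comb a v (suc l) + comb a v zero * q l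
    comb-reduced a l = begin
      comb (a ∘ punchIn p) reduced l                                             ≈⟨ +-identityˡ _ ⟨
      0# + comb (a ∘ punchIn p) reduced l                                        ≈⟨ +-congʳ (trans (*-congˡ (full-p l)) (zeroʳ (a p))) ⟨
      a p * full p l + comb (a ∘ punchIn p) reduced l                            ≈⟨ sum-remove {i = p} (λ i → a i * full i l) ⟨
      sum (λ i → a i * full i l)                                                 ≈⟨ sum-cong-≋ (λ i → trans (distribˡ (a i) (v i (suc l)) (v i zero * q l)) (+-congˡ (sym (*-assoc (a i) (v i zero) (q l))))) ⟩
      sum (λ i → a i * v i (suc l) + a i * v i zero * q l)                       ≈⟨ ∑-distrib-+ (λ i → a i * v i (suc l)) (λ i → a i * v i zero * q l) ⟩
      comb a v (suc l) + sum (λ i → a i * v i zero * q l)                        ≈⟨ +-congˡ (*-distribʳ-sum (q l) (λ i → a i * v i zero)) ⟨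
      comb a v (suc l) + comb a v zero * q l                                     ∎
      where open ≈-Reasoning

    comb-reduced₀ : ∀ a → comb a v zero ≈ 0# → ∀ l → comb (a ∘ punchIn p) reduced l ≈ comb a v (suc l)
    comb-reduced₀ a h l = trans (comb-reduced a l) (trans (+-congˡ (trans (*-congʳ h) (zeroˡ (q l)))) (+-identityʳ _))

    independent : Independent reduced → Independent v
    independent ind a h i with i ≟ p
    ... | no i≢p = trans (reflexive (≡.cong a (≡.sym (punchIn-punchOut (i≢p ∘ ≡.sym))))) (others (punchOut (i≢p ∘ ≡.sym)))
      where
      others : ∀ j → a (punchIn p j) ≈ 0#
      others = ind (a ∘ punchIn p) λ l → trans (comb-reduced₀ a (h zero) l) (h (suc l))
    ... | yes ≡.refl = cancel-≉0 pivot (begin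
      a p * v p zero                                          ≈⟨ +-identityʳ _ ⟨
      a p * v p zero + 0#                                     ≈⟨ +-congˡ (comb-zero (a ∘ punchIn p) (v ∘ punchIn p) zero others) ⟨
      a p * v p zero + sum (λ j → a (punchIn p j) * v (punchIn p j) zero)   ≈⟨ sum-remove {i = p} (λ i → a i * v i zero) ⟨
      comb a v zero                                           ≈⟨ h zero ⟩
      0#                                                      ∎)
      where
      open ≈-Reasoning
      others : ∀ j → a (punchIn p j) ≈ 0#
      others = ind (a ∘ punchIn p) λ l → trans (comb-reduced₀ a (h zero) l) (h (suc l))

    dependent : Dependent reduced → Dependent v
    dependent (a′ , j , a′j≉0 , h) = a , punchIn p j , (λ eq → a′j≉0 (trans (sym (a-in j)) eq)) , vanish
      where
      rest = comb a′ (v ∘ punchIn p) zero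
      a : Fin (suc n) → Carrier
      -- The coefficient of the pivot row cancels the contribution of the other rows to the pivot
      -- column.
      a = insertAt a′ p (- (rest * y))
      a-in : ∀ i → a (punchIn p i) ≈ a′ i
      a-in i = reflexive (insertAt-punchIn a′ p _ i)
      vanish₀ : comb a v zero ≈ 0#
      vanish₀ = begin
        comb a v zero                                        ≈⟨ sum-remove {i = p} (λ i → a i * v i zero) ⟩
        a p * v p zero + comb (a ∘ punchIn p) (v ∘ punchIn p) zero
          ≈⟨ +-cong (*-congʳ (reflexive (insertAt-lookup a′ p _))) (sum-cong-≋ λ i → *-congʳ (a-in i)) ⟩
        - (rest * y) * v p zero + rest                       ≈⟨ +-congʳ (-‿distribˡ-* _ _) ⟨
        - (rest * y * v p zero) + rest                       ≈⟨ +-congʳ (-‿cong (*-assoc _ _ _)) ⟩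
        - (rest * (y * v p zero)) + rest                     ≈⟨ +-congʳ (-‿cong (*-congˡ (trans (*-comm _ _) (proj₂ (inverse (v p zero) pivot))))) ⟩
        - (rest * 1#) + rest                                 ≈⟨ +-congʳ (-‿cong (*-identityʳ _)) ⟩
        - rest + rest                                        ≈⟨ -‿inverseˡ _ ⟩
        0#                                                   ∎
        where open ≈-Reasoning
      vanish : ∀ l → comb a v l ≈ 0#
      vanish zero = vanish₀
      vanish (suc l) = trans (sym (comb-reduced₀ a vanish₀ l)) (trans (sum-cong-≋ λ i → *-congʳ (a-in i)) (h l))

  first-column : ∀ {n d} (v : Fin n → Fin (suc d) → Carrier) → ¬ ¬ ((∀ i → v i zero ≈ 0#) ⊎ ∃[ i ] ¬ v i zero ≈ 0#)
  first-column v k = ¬¬-∀ (λ i → ¬¬-excluded-middle {A = v i zero ≈ 0#}) λ dec → k (decide dec)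
    where
    decide : (∀ i → Dec (v i zero ≈ 0#)) → _
    decide dec with any? (λ i → ¬? (dec i))
    ... | yes found = inj₂ found
    ... | no none = inj₁ λ i → decidable-stable (dec i) λ ne → none (i , ne)

  comb-zero-column : ∀ {n d} (v : Fin n → Fin (suc d) → Carrier) → (∀ i → v i zero ≈ 0#) → ∀ a → comb a v zero ≈ 0#
  comb-zero-column v z a = sum-zero (λ i → a i * v i zero) λ i → trans (*-congˡ (z i)) (zeroʳ (a i))

  tails : ∀ {n d} → (Fin n → Fin (suc d) → Carrier) → Fin n → Fin d → Carrier
  tails v i l = v i (suc l)

  -- Every pivot uses up a row and a column, which gives `n ≤ d`; a row left when no columns remain
  -- is dependent.
  gauss : ∀ {n} d (v : Fin n → Fin d → Carrier) → ¬ ¬ ((Independent v × n ≤ d) ⊎ Dependent v)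
  gauss {zero} zero v k = k (inj₁ ((λ a h ()) , z≤n))
  gauss {suc n} zero v k = k (inj₂ ((λ _ → 1#) , zero , 1≉0 , λ ()))
  gauss {n} (suc d) v k = first-column v step
    where
    step : ((∀ i → v i zero ≈ 0#) ⊎ ∃[ i ] ¬ v i zero ≈ 0#) → ⊥
    step (inj₁ z) = gauss d (tails v) λ
      { (inj₁ (ind , n≤d)) → k (inj₁ ((λ a h → ind a (h ∘ suc)) , m≤n⇒m≤1+n n≤d))
      ; (inj₂ (a , i , ai≉0 , h)) → k (inj₂ (a , i , ai≉0 , λ { zero → comb-zero-column v z a ; (suc l) → h l })) }
    step (inj₂ (p , pivot)) = eliminate v p pivot k
      where
      eliminate : ∀ {n} (v : Fin n → Fin (suc d) → Carrier) p → ¬ v p zero ≈ 0# → ¬ ¬ ((Independent v × n ≤ suc d) ⊎ Dependent v)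
      eliminate {suc n} v p pivot k = gauss d reduced λ
        { (inj₁ (ind , n≤d)) → k (inj₁ (independent ind , s≤s n≤d))
        ; (inj₂ dep) → k (inj₂ (dependent dep)) }
        where open Eliminate v p pivot

  -- The coordinates `π` are the pivot columns of an echelon form; projection to them is injective
  -- on the span of `v`.
  Pivots : ∀ {n d} → (Fin n → Fin d → Carrier) → Set (c ⊔ ℓ)
  Pivots {n} {d} v = Σ[ s ∈ ℕ ] (s ≤ n × Σ[ π ∈ (Fin s → Fin d) ]
    (∀ a → (∀ i → comb a v (π i) ≈ 0#) → ∀ l → comb a v l ≈ 0#))

  pivots : ∀ {n} d (v : Fin n → Fin d → Carrier) → ¬ ¬ Pivots v
  pivots zero v k = k (0 , z≤n , (λ ()) , λ _ _ ())
  pivots {n} (suc d) v k = first-column v step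
    where
    step : ((∀ i → v i zero ≈ 0#) ⊎ ∃[ i ] ¬ v i zero ≈ 0#) → ⊥
    step (inj₁ z) = pivots d (tails v) λ { (s , s≤n , π , det) →
      k (s , s≤n , suc ∘ π , λ a h → λ { zero → comb-zero-column v z a ; (suc l) → det a h l }) }
    step (inj₂ (p , pivot)) = eliminate v p pivot k
      where
      eliminate : ∀ {n} (v : Fin n → Fin (suc d) → Carrier) p → ¬ v p zero ≈ 0# → ¬ ¬ Pivots v
      eliminate {suc n} v p pivot k = pivots d reduced λ { (s , s≤n , π , det) →
        k (suc s , s≤s s≤n , (λ { zero → zero ; (suc i) → suc (π i) }) , λ a h → λ
          { zero → h zero
          ; (suc l) → trans (sym (comb-reduced₀ a (h zero) l))
                        (det (a ∘ punchIn p) (λ i → trans (comb-reduced₀ a (h zero) (π i)) (h (suc i))) l) }) }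
        where open Eliminate v p pivot

  -- The matroid of linear span

  module _ {N d : ℕ} (v : Fin N → Fin d → Carrier) where

    -- A combination is a list of terms, possibly repeating `e`, so that no enumeration of `P`
    -- enters the definition.
    data Span (P : Fin N → Set) : (Fin d → Carrier) → Set (c ⊔ ℓ) where
      nil  : ∀ {u} → (∀ l → u l ≈ 0#) → Span P u
      cons : ∀ {e u w} → P e → (b : Carrier) → Span P w → (∀ l → u l ≈ b * v e l + w l) → Span P u

    private
      variable
        P Q : Fin N → Set
        u w : Fin d → Carrier

    span-resp : (∀ l → u l ≈ w l) → Span P w → Span P u
    span-resp eq (nil z) = nil λ l → trans (eq l) (z l)
    span-resp eq (cons pe b s h) = cons pe b s λ l → trans (eq l) (h l)

    span-+ : Span P u → Span P w → Span P (λ l → u l + w l)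
    span-+ (nil z) s = span-resp (λ l → trans (+-congʳ (z l)) (+-identityˡ _)) s
    span-+ (cons pe b s h) s′ = cons pe b (span-+ s s′) λ l → trans (+-congʳ (h l)) (+-assoc _ _ _)

    span-* : ∀ b → Span P u → Span P (λ l → b * u l)
    span-* b (nil z) = nil λ l → trans (*-congˡ (z l)) (zeroʳ b)
    span-* b (cons pe b′ s h) = cons pe (b * b′) (span-* b s) λ l →
      trans (*-congˡ (h l)) (trans (distribˡ b _ _) (+-congʳ (sym (*-assoc b b′ _))))

    span-incl : ∀ {e} → P e → Span P (v e)
    span-incl pe = cons pe 1# (nil {u = λ _ → 0#} λ _ → refl) λ l → sym (trans (+-identityʳ _) (*-identityˡ _))

    span-trans : (∀ e → P e → Span Q (v e)) → Span P u → Span Q u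
    span-trans f (nil z) = nil z
    span-trans f (cons {e} pe b s h) = span-resp h (span-+ (span-* b (f e pe)) (span-trans f s))

    span-comb : ∀ {n} (f : Fin n → Fin N) (a : Fin n → Carrier) → (∀ i → P (f i)) → Span P (comb a (v ∘ f))
    span-comb {n = zero} f a h = nil λ _ → refl
    span-comb {n = suc n} f a h = cons (h zero) (a zero) (span-comb (f ∘ suc) (a ∘ suc) (h ∘ suc)) λ l → refl

    span-coefficients : ∀ {n} (f : Fin n → Fin N) → (∀ e → P e → ∃[ i ] f i ≡ e) → Span P u →
      Σ[ a ∈ (Fin n → Carrier) ] (∀ l → u l ≈ comb a (v ∘ f) l)
    span-coefficients f onto (nil z) = (λ _ → 0#) , λ l → trans (z l) (sym (comb-zero (λ _ → 0#) (v ∘ f) l λ _ → refl))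
    span-coefficients {n = n} f onto (cons {e} pe b s h)
      with a , eq ← span-coefficients f onto s | i , ≡.refl ← onto e pe = (λ j → δ i b j + a j) , λ l → begin
        _                                                          ≈⟨ h l ⟩
        b * v (f i) l + _                                          ≈⟨ +-cong (sym (comb-δ i b (v ∘ f) l)) (eq l) ⟩
        comb (δ i b) (v ∘ f) l + comb a (v ∘ f) l                        ≈⟨ ∑-distrib-+ (λ j → δ i b j * v (f j) l) (λ j → a j * v (f j) l) ⟨
        sum (λ j → δ i b j * v (f j) l + a j * v (f j) l)              ≈⟨ sum-cong-≋ (λ j → distribʳ (v (f j) l) (δ i b j) (a j)) ⟨
        comb (λ j → δ i b j + a j) (v ∘ f) l                           ∎
      where open ≈-Reasoning

    span-split : ∀ {y} → Span (P ⊕ y) u → Σ[ b ∈ Carrier ] Σ[ w ∈ (Fin d → Carrier) ] (Span P w × ∀ l → u l ≈ b * v y l + w l)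
    span-split {u = u} (nil z) = 0# , u , nil z , λ l → sym (trans (+-congʳ (zeroˡ _)) (+-identityˡ _))
    span-split (cons (inj₁ pe) b s h) with b′ , w′ , s′ , h′ ← span-split s =
      b′ , (λ l → b * v _ l + w′ l) , cons pe b s′ (λ _ → refl) , λ l →
        trans (h l) (trans (+-congˡ (h′ l)) (trans (sym (+-assoc _ _ _)) (trans (+-congʳ (+-comm _ _)) (+-assoc _ _ _))))
    span-split (cons (inj₂ ≡.refl) b s h) with b′ , w′ , s′ , h′ ← span-split s =
      b + b′ , w′ , s′ , λ l →
        trans (h l) (trans (+-congˡ (h′ l)) (trans (sym (+-assoc _ _ _)) (+-congʳ (sym (distribʳ _ b b′)))))

    -- The coefficient of `y` in `v x` is nonzero, or `v x` would lie in the span of `P`; so the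
    -- equation can be solved for `v y`. Whether it vanishes is decided under double negation.
    span-exchange : ∀ {x y} → Span (P ⊕ y) (v x) → ¬ Span P (v x) → ¬ ¬ Span (P ⊕ x) (v y)
    span-exchange {P} {x} {y} s ∉P k with b , w , s′ , h ← span-split s = ¬¬-excluded-middle {A = b ≈ 0#} λ
      { (yes b≈0) → ∉P (span-resp (λ l → trans (h l) (trans (+-congʳ (trans (*-congʳ b≈0) (zeroˡ _))) (+-identityˡ _))) s′)
      ; (no b≉0) → k (invert (inverse b b≉0) s′ h) }
      where
      invert : ∀ {b w} → Σ[ b⁻¹ ∈ Carrier ] (b * b⁻¹ ≈ 1#) → Span P w → (∀ l → v x l ≈ b * v y l + w l) → Span (P ⊕ x) (v y)
      invert {b} {w} (b⁻¹ , bb⁻¹≈1) s′ h =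
        cons (inj₂ ≡.refl) b⁻¹ (span-* (- b⁻¹) (span-trans (λ e pe → span-incl (inj₁ pe)) s′)) λ l → sym (begin
          b⁻¹ * v x l + - b⁻¹ * w l                     ≈⟨ +-cong (*-congˡ (h l)) (sym (-‿distribˡ-* b⁻¹ (w l))) ⟩
          b⁻¹ * (b * v y l + w l) + - (b⁻¹ * w l)       ≈⟨ +-congʳ (distribˡ b⁻¹ _ _) ⟩
          b⁻¹ * (b * v y l) + b⁻¹ * w l + - (b⁻¹ * w l) ≈⟨ +-assoc _ _ _ ⟩
          b⁻¹ * (b * v y l) + (b⁻¹ * w l + - (b⁻¹ * w l)) ≈⟨ +-cong (sym (*-assoc b⁻¹ b (v y l))) (-‿inverseʳ _) ⟩
          b⁻¹ * b * v y l + 0#                          ≈⟨ +-identityʳ _ ⟩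
          b⁻¹ * b * v y l                               ≈⟨ *-congʳ (trans (*-comm b⁻¹ b) bb⁻¹≈1) ⟩
          1# * v y l                                    ≈⟨ *-identityˡ _ ⟩
          v y l                                         ∎)
        where open ≈-Reasoning

    dependent⇒span : ∀ {n} (f : Fin n → Fin N) → Injective _≡_ _≡_ f → (∀ i → P (f i)) → Dependent (v ∘ f) →
      ∃[ i ] Span (P ⊝ f i) (v (f i))
    dependent⇒span {P} {suc n} f inj f∈ (a , i , ai≉0 , h) with b , ab≈1 ← inverse (a i) ai≉0 =
      i , span-resp (λ l → express l) (span-* (- b) (span-comb (f ∘ punchIn i) (a ∘ punchIn i)
        λ j → f∈ (punchIn i j) , λ eq → punchInᵢ≢i i j (inj eq)))
      where
      open ≈-Reasoning
      express : ∀ l → v (f i) l ≈ - b * comb (a ∘ punchIn i) (v ∘ f ∘ punchIn i) l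
      express l = x∙y⁻¹≈ε⇒x≈y _ _ (begin
        v (f i) l + - (- b * r)            ≈⟨ +-congˡ (-‿cong (-‿distribˡ-* b r)) ⟨
        v (f i) l + - (- (b * r))          ≈⟨ +-congˡ (-‿involutive (b * r)) ⟩
        v (f i) l + b * r                  ≈⟨ +-congʳ (trans (*-congʳ (trans (*-comm b (a i)) ab≈1)) (*-identityˡ _)) ⟨
        b * a i * v (f i) l + b * r        ≈⟨ +-congʳ (*-assoc b (a i) _) ⟩
        b * (a i * v (f i) l) + b * r      ≈⟨ distribˡ b _ _ ⟨
        b * (a i * v (f i) l + r)          ≈⟨ *-congˡ (sum-remove {i = i} (λ j → a j * v (f j) l)) ⟨
        b * comb a (v ∘ f) l               ≈⟨ *-congˡ (h l) ⟩
        b * 0#                             ≈⟨ zeroʳ b ⟩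
        0#                                 ∎)
        where r = comb (a ∘ punchIn i) (v ∘ f ∘ punchIn i) l

    -- Subsets given by `Vec Bool N` are finite in number, so all these decisions together exist up
    -- to double negation; `span?` transfers them to arbitrary decidable subsets.
    SpanDec : Set (c ⊔ ℓ)
    SpanDec = ∀ (S : Vec Bool N) x → Dec (Span (λ e → lookup S e ≡ true) (v x))

    module SpanMatroid (dec : SpanDec) where

      span? : ∀ {P} → Decidable P → Decidable (Span P ∘ v)
      span? P? x = map′ (span-trans λ e eq → span-incl (holds e eq)) (span-trans λ e pe → span-incl (holds⁻ e pe)) (dec S x)
        where
        S = tabulate (does ∘ P?)
        holds : ∀ e → lookup S e ≡ true → _
        holds e eq with P? e | ≡.trans (≡.sym (lookup∘tabulate (does ∘ P?) e)) eq
        ... | yes pe | _ = pe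
        holds⁻ : ∀ e → _ → lookup S e ≡ true
        holds⁻ e pe with P? e | lookup∘tabulate (does ∘ P?) e
        ... | yes _ | eq = eq
        ... | no ¬pe | _ = contradiction pe ¬pe

      spanMatroid : Matroid N (c ⊔ ℓ)
      spanMatroid = record
        { cl       = λ P x → Span P (v x)
        ; cl?      = span?
        ; cl-incl  = span-incl
        ; cl-trans = λ f → span-trans f
        ; cl-exch  = λ P? {x} {y} s ∉P → decidable-stable (span? (⊕-dec P? x) y) (span-exchange s ∉P)
        }

      open Matroid spanMatroid using (Ind)

      independent-family : ∀ {n} (f : Fin n → Fin N) → Injective _≡_ _≡_ f → (∀ i → P (f i)) → Ind P →
        ¬ ¬ (Independent (v ∘ f) × n ≤ d)
      independent-family f inj f∈ ind k = gauss d (v ∘ f) λ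
        { (inj₁ good) → k good
        ; (inj₂ dep) → let i , s = dependent⇒span f inj f∈ dep in ind (f i) (f∈ i) s }

      rank≤ : (P? : Decidable P) → Ind P → count P? ≤ d
      rank≤ P? ind = decidable-stable (count P? ≤? d) λ k →
        independent-family (enum P?) (enum-injective P?) (enum-∈ P?) ind (k ∘ proj₂)

  ¬¬-∀Vec : ∀ {p} N {P : Vec Bool N → Set p} → (∀ S → ¬ ¬ P S) → ¬ ¬ (∀ S → P S)
  ¬¬-∀Vec zero h k = h [] λ p → k λ { [] → p }
  ¬¬-∀Vec (suc N) h k = ¬¬-∀Vec N (λ S → h (true ∷ S)) λ t → ¬¬-∀Vec N (λ S → h (false ∷ S)) λ f →
    k λ { (true ∷ S) → t S ; (false ∷ S) → f S }

  span-dec : ∀ {N d} (v : Fin N → Fin d → Carrier) → ¬ ¬ SpanDec v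
  span-dec {N} v = ¬¬-∀Vec N λ S → ¬¬-∀ λ x → ¬¬-excluded-middle

  comb-linear : ∀ {n d} (a b : Fin n → Carrier) s (v : Fin n → Fin d → Carrier) l →
    comb (λ i → a i + s * b i) v l ≈ comb a v l + s * comb b v l
  comb-linear a b s v l = begin
    sum (λ i → (a i + s * b i) * v i l)           ≈⟨ sum-cong-≋ (λ i → trans (distribʳ (v i l) (a i) (s * b i)) (+-congˡ (*-assoc s (b i) (v i l)))) ⟩
    sum (λ i → a i * v i l + s * (b i * v i l))   ≈⟨ ∑-distrib-+ (λ i → a i * v i l) (λ i → s * (b i * v i l)) ⟩
    comb a v l + sum (λ i → s * (b i * v i l))    ≈⟨ +-congˡ (*-distribˡ-sum s (λ i → b i * v i l)) ⟨
    comb a v l + s * comb b v l                   ∎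
    where open ≈-Reasoning

  module _ {k N d : ℕ} .{{_ : NonZero k}} (τ : Fin k → Carrier) (τ-inj : Injective _≡_ _≈_ τ)
    (coord : Fin N → Fin d → Fin k) (coord-inj : ∀ e e′ → (∀ l → coord e l ≡ coord e′ l) → e ≡ e′) where

    private
      v : Fin N → Fin d → Carrier
      v e l = τ (coord e l)

    -- Two elements of the flat agreeing in the pivot coordinates of a generating family are equal.
    flat≤ : (dec : SpanDec v) {P : Fin N → Set} (P? : Decidable P) → count (SpanMatroid.span? v dec P?) ≤ k ^ count P?
    flat≤ dec {P} P? = decidable-stable (_ ≤? _) λ κ → pivots d (v ∘ enum P?) λ { (s , s≤ , π , det) → κ (bound s s≤ π det) }
      where
      C? = SpanMatroid.span? v dec P?
      coefficients : ∀ i → Σ[ a ∈ (Fin (count P?) → Carrier) ] (∀ l → v (enum C? i) l ≈ comb a (v ∘ enum P?) l)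
      coefficients i = span-coefficients v (enum P?) (λ e pe → index P? e pe , enum-index P? e pe) (enum-∈ C? i)
      bound : ∀ s → s ≤ count P? → (π : Fin s → Fin d) →
        (∀ a → (∀ i → comb a (v ∘ enum P?) (π i) ≈ 0#) → ∀ l → comb a (v ∘ enum P?) l ≈ 0#) → count C? ≤ k ^ count P?
      bound s s≤ π det = ≤-trans (injective⇒≤ {f = code} code-inj) (^-monoʳ-≤ k s≤)
        where
        code : Fin (count C?) → Fin (k ^ s)
        code i = funToFin (λ j → coord (enum C? i) (π j))
        code-inj : Injective _≡_ _≡_ code
        code-inj {i} {j} eq = enum-injective C? (coord-inj _ _ λ l → τ-inj (agree l))
          where
          a = proj₁ (coefficients i)
          b = proj₁ (coefficients j)
          difference : ∀ l → comb (λ q → a q + - 1# * b q) (v ∘ enum P?) l ≈ v (enum C? i) l + - v (enum C? j) l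
          difference l = trans (comb-linear a b (- 1#) (v ∘ enum P?) l)
            (+-cong (sym (proj₂ (coefficients i) l)) (trans (-1*x≈-x _) (-‿cong (sym (proj₂ (coefficients j) l)))))
          pivots-agree : ∀ q → coord (enum C? i) (π q) ≡ coord (enum C? j) (π q)
          pivots-agree q = ≡.trans (≡.sym (finToFun-funToFin _ q)) (≡.trans (≡.cong (λ z → finToFun z q) eq) (finToFun-funToFin _ q))
          agree : ∀ l → v (enum C? i) l ≈ v (enum C? j) l
          agree l = x∙y⁻¹≈ε⇒x≈y _ _ (trans (sym (difference l)) (det _ (λ q → trans (difference (π q))
            (trans (+-congʳ (reflexive (≡.cong τ (pivots-agree q)))) (-‿inverseʳ _))) l))

open import Data.Nat using (_+_; _*_)
open import Data.Nat.Properties hiding (suc-injective; _≟_)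
open ≡ using (refl; sym; trans; cong; cong₂; subst)

-- Growth of powers

module _ {k : ℕ} (2≤k : 2 ≤ k) where

  private
    instance
      k≢0 : NonZero k
      k≢0 = >-nonZero (≤-trans (s≤s z≤n) 2≤k)

  -- The induction step of `^-convex`, resting on `2 * k ^ n ≤ k ^ suc n`.
  ^-step : ∀ {r n} → r ≤ n → k ^ r + r * k ^ n ≤ r * k ^ suc n + 1
  ^-step {r} {n} r≤n = begin
    k ^ r + r * k ^ n               ≤⟨ +-monoˡ-≤ (r * k ^ n) (small r r≤n) ⟩
    (r * k ^ n + 1) + r * k ^ n     ≡⟨ solve 2 (λ r K → (r :* K :+ con 1) :+ r :* K := r :* (con 2 :* K) :+ con 1) refl r (k ^ n) ⟩
    r * (2 * k ^ n) + 1             ≤⟨ +-monoˡ-≤ 1 (*-monoʳ-≤ r (*-monoˡ-≤ (k ^ n) 2≤k)) ⟩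
    r * k ^ suc n + 1               ∎
    where
    open ≤-Reasoning
    open +-*-Solver
    small : ∀ r → r ≤ n → k ^ r ≤ r * k ^ n + 1
    small zero _ = s≤s z≤n
    small (suc r) r≤n = ≤-trans (^-monoʳ-≤ k r≤n) (≤-trans (m≤m+n (k ^ n) (r * k ^ n)) (m≤m+n _ 1))

  -- (k ^ r - 1) / r ≤ (k ^ n - 1) / n for r ≤ n, with the subtractions moved to the other side.
  ^-convex : ∀ {r} n → r ≤ n → n * k ^ r + r ≤ r * k ^ n + n
  ^-convex {r} n r≤n with m≤n⇒m<n∨m≡n r≤n
  ... | inj₂ refl = ≤-refl
  ^-convex {r} (suc n) _ | inj₁ (s≤s r≤n) = begin
    (k ^ r + n * k ^ r) + r          ≡⟨ +-assoc (k ^ r) (n * k ^ r) r ⟩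
    k ^ r + (n * k ^ r + r)          ≤⟨ +-monoʳ-≤ (k ^ r) (^-convex n r≤n) ⟩
    k ^ r + (r * k ^ n + n)          ≡⟨ +-assoc (k ^ r) (r * k ^ n) n ⟨
    (k ^ r + r * k ^ n) + n          ≤⟨ +-monoˡ-≤ n (^-step r≤n) ⟩
    (r * k ^ suc n + 1) + n          ≡⟨ +-assoc (r * k ^ suc n) 1 n ⟩
    r * k ^ suc n + suc n            ∎
    where open ≤-Reasoning

  -- By convexity `(k ^ r - 1) / r ≤ (k ^ n - 1) / n ≤ t`, here multiplied out.
  slow-growth : ∀ {r t} n → r ≤ n → k ^ n ≤ t * n + 1 → k ^ r ≤ t * r + 1
  slow-growth {t = t} zero z≤n h = m≤n+m 1 (t * 0)
  slow-growth {r} {t} n@(suc _) r≤n h = *-cancelˡ-≤ n (+-cancelʳ-≤ r _ _ (begin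
    n * k ^ r + r              ≤⟨ ^-convex n r≤n ⟩
    r * k ^ n + n              ≤⟨ +-monoˡ-≤ n (*-monoʳ-≤ r h) ⟩
    r * (t * n + 1) + n        ≡⟨ solve 3 (λ r t n → r :* (t :* n :+ con 1) :+ n := n :* (t :* r :+ con 1) :+ r) refl r t n ⟩
    n * (t * r + 1) + r        ∎))
    where
    open ≤-Reasoning
    open +-*-Solver

  -- By convexity the chord of `k ^ _` from `r` to `r + q` is at least as steep as the one from 0 to
  -- `r + q`, whose slope is at least `t`.
  fast-growth : ∀ {t} r q → t * (r + q) + 1 ≤ k ^ (r + q) → k ^ r + t * q ≤ k ^ (r + q)
  fast-growth {t} r zero h = ≤-reflexive (trans (cong (k ^ r +_) (*-zeroʳ t)) (trans (+-identityʳ _) (cong (k ^_) (sym (+-identityʳ r)))))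
  fast-growth {t} r q@(suc _) h = convex (r + q) {{>-nonZero (≤-trans (s≤s z≤n) (m≤n+m q r))}} refl
    where
    open ≤-Reasoning
    open +-*-Solver
    convex : ∀ n .{{_ : NonZero n}} → n ≡ r + q → k ^ r + t * q ≤ k ^ (r + q)
    convex n refl = *-cancelˡ-≤ n (+-cancelʳ-≤ (r + q) _ _ (begin
      n * (k ^ r + t * q) + (r + q)                       ≡⟨ solve 5 (λ n R t q r → n :* (R :+ t :* q) :+ (r :+ q) := (n :* R :+ r) :+ q :* (t :* n :+ con 1)) refl n (k ^ r) t q r ⟩
      (n * k ^ r + r) + q * (t * n + 1)                   ≤⟨ +-mono-≤ (^-convex n (m≤m+n r q)) (*-monoʳ-≤ q h) ⟩
      (r * k ^ n + n) + q * k ^ n                         ≡⟨ solve 3 (λ r q K → (r :* K :+ (r :+ q)) :+ q :* K := (r :+ q) :* K :+ (r :+ q)) refl r q (k ^ n) ⟩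
      n * k ^ n + (r + q)                                 ∎))

  flat-bound : ∀ {t d} → t * d + 1 ≤ k ^ d → ∀ r → r ≤ d → k ^ r + t * d ≤ k ^ d + t * r
  flat-bound {t} h r r≤d with q , refl ← m≤n⇒∃[o]m+o≡n r≤d = begin
    k ^ r + t * (r + q)          ≡⟨ solve 4 (λ R t r q → R :+ t :* (r :+ q) := (R :+ t :* q) :+ t :* r) refl (k ^ r) t r q ⟩
    (k ^ r + t * q) + t * r      ≤⟨ +-monoˡ-≤ (t * r) (fast-growth {t} r q h) ⟩
    k ^ (r + q) + t * r          ∎
    where
    open ≤-Reasoning
    open +-*-Solver

  -- The condition `g-m` when a flat of rank `r` has at most `t * r + 1` points.
  colour-bound-slow : ∀ {t n m} → k ^ n ≤ t * n + 1 → 1 + t * suc n < m → ∀ r → r < suc n →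
    k ^ r + suc (t * suc n) ≤ m + t * r
  colour-bound-slow {t} {n} {m} h big r (s≤s r≤n) = begin
    k ^ r + suc (t * suc n)            ≤⟨ +-monoˡ-≤ (suc (t * suc n)) (slow-growth {t = t} n r≤n h) ⟩
    (t * r + 1) + suc (t * suc n)      ≡⟨ solve 2 (λ x y → (x :+ con 1) :+ (con 1 :+ y) := (con 1 :+ (con 1 :+ y)) :+ x) refl (t * r) (t * suc n) ⟩
    suc (1 + t * suc n) + t * r        ≤⟨ +-monoˡ-≤ (t * r) big ⟩
    m + t * r                          ∎
    where
    open ≤-Reasoning
    open +-*-Solver

  -- The condition `g-m` when rank `n`, that is corank 2, is the critical one; `flat-bound` reduces
  -- smaller ranks to it.
  colour-bound-fast : ∀ {t n m} → t * n + 1 ≤ k ^ n → k ^ n + t < m → ∀ r → r < suc n →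
    k ^ r + suc (t * suc n) ≤ m + t * r
  colour-bound-fast {t} {n} {m} h big r (s≤s r≤n) = begin
    k ^ r + suc (t * suc n)            ≡⟨ solve 3 (λ R t n → R :+ (con 1 :+ t :* (con 1 :+ n)) := con 1 :+ ((R :+ t :* n) :+ t)) refl (k ^ r) t n ⟩
    suc ((k ^ r + t * n) + t)          ≤⟨ s≤s (+-monoˡ-≤ t (flat-bound {t} h r r≤n)) ⟩
    suc ((k ^ n + t * r) + t)          ≡⟨ solve 3 (λ K x t → con 1 :+ ((K :+ x) :+ t) := (con 1 :+ (K :+ t)) :+ x) refl (k ^ n) (t * r) t ⟩
    suc (k ^ n + t) + t * r            ≤⟨ +-monoˡ-≤ (t * r) big ⟩
    m + t * r                          ∎
    where
    open ≤-Reasoning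
    open +-*-Solver

  -- From rank `n` to rank `n + 2` the powers grow by at least `2 * t`. This leaves enough points
  -- for the colours of `hide-flat`.
  room : ∀ {t} n → t * suc (suc n) + 1 ≤ k ^ suc (suc n) → k ^ n + t ≤ k ^ suc (suc n)
  room {t} n h = +-cancelʳ-≤ (t * n) _ _ (begin
    (k ^ n + t) + t * n            ≤⟨ +-monoʳ-≤ (k ^ n + t) (m≤n+m (t * n) t) ⟩
    (k ^ n + t) + (t + t * n)      ≡⟨ solve 3 (λ K t n → (K :+ t) :+ (t :+ t :* n) := K :+ t :* (con 2 :+ n)) refl (k ^ n) t n ⟩
    k ^ n + t * suc (suc n)        ≤⟨ flat-bound {t} h n (m≤n+m n 2) ⟩
    k ^ suc (suc n) + t * n        ∎)
    where
    open ≤-Reasoning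
    open +-*-Solver

-- Lexicographic numbering of Vec (Fin (1 + k)) d in which the index z counts as the smallest digit

combine-low : ∀ {m n} (i : Fin (suc m)) (j : Fin n) → toℕ (combine i j) < n → i ≡ zero × toℕ (combine i j) ≡ toℕ j
combine-low {m} {n} zero j lt = refl , toℕ-↑ˡ j (m * n)
combine-low {suc m} {n} (suc i) j lt = contradiction (subst (_< n) (toℕ-↑ʳ n (combine i j)) lt) (m+n≮m n _)

funToFin-cong : ∀ {m n} {f g : Fin m → Fin n} → f ≗ g → funToFin f ≡ funToFin g
funToFin-cong {zero} h = refl
funToFin-cong {suc m} h = cong₂ combine (h zero) (funToFin-cong (h ∘ suc))

funToFin-zero : ∀ {m n} (f : Fin m → Fin (suc n)) → toℕ (funToFin f) ≡ 0 → ∀ l → f l ≡ zero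
funToFin-zero {suc m} {n} f eq = λ { zero → proj₁ low ; (suc l) → funToFin-zero (f ∘ suc) (trans (sym (proj₂ low)) eq) l }
  where
  low = combine-low (f zero) (funToFin (f ∘ suc)) (subst (_< suc n ^ m) (sym eq) (m^n>0 (suc n) m))

module Coding {k : ℕ} (z : Fin (suc k)) {d : ℕ} where

  private
    swap : Fin (suc k) → Fin (suc k)
    swap = transpose z zero
    unswap : Fin (suc k) → Fin (suc k)
    unswap = transpose zero z

  swap-zero : ∀ {i} → swap i ≡ zero → i ≡ z
  swap-zero {i} eq = trans (sym (transpose-inverse zero z)) (trans (cong unswap eq) refl)

  code : Vec (Fin (suc k)) d → Fin (suc k ^ d)
  code x = funToFin (swap ∘ lookup x)

  point : Fin (suc k ^ d) → Vec (Fin (suc k)) d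
  point e = tabulate (unswap ∘ finToFun e)

  point-code : ∀ x → point (code x) ≡ x
  point-code x = trans (tabulate-cong λ l → trans (cong unswap (finToFun-funToFin (swap ∘ lookup x) l)) (transpose-inverse zero z))
    (tabulate∘lookup x)

  code-point : ∀ e → code (point e) ≡ e
  code-point e = trans (funToFin-cong {d} {g = finToFun e} λ l → trans (cong swap (lookup∘tabulate (unswap ∘ finToFun e) l)) (transpose-inverse z zero))
    (funToFin-finToFin {d} {suc k} e)

  code-injective : ∀ {x y} → code x ≡ code y → x ≡ y
  code-injective {x} {y} eq = trans (sym (point-code x)) (trans (cong point eq) (point-code y))

  code-zero : ∀ x → toℕ (code x) ≡ 0 → ∀ l → lookup x l ≡ z
  code-zero x eq l = swap-zero (funToFin-zero (swap ∘ lookup x) eq l)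

-- Small numbers have leading digits zero, so the flat on which the first two coordinates vanish
-- comes first in the numbering.
code-low : ∀ {k n} (z : Fin (suc k)) (x : Vec (Fin (suc k)) (suc (suc n))) → toℕ (Coding.code z x) < suc k ^ n →
  lookup x zero ≡ z × lookup x (suc zero) ≡ z
code-low {k} {n} z x lt = Coding.swap-zero z {suc (suc n)} (proj₁ low₀) , Coding.swap-zero z {suc (suc n)} (proj₁ low₁)
  where
  f = transpose z zero ∘ lookup x
  low₀ = combine-low (f zero) (funToFin {suc n} (f ∘ suc)) (<-≤-trans lt (m≤m+n _ _))
  low₁ = combine-low (f (suc zero)) (funToFin {n} (λ l → f (suc (suc l)))) (subst (_< suc k ^ n) (proj₂ low₀) lt)

-- Bounds for colourings of `T^d`

module _ {c ℓ : Level} (F : Field c ℓ) where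
  open Linear F
  private module K = Field F

  module Points {k : ℕ} (τ : Fin (suc k) → K.Carrier) (z : Fin (suc k)) (τz≈0 : τ z K.≈ K.0#)
    (d : ℕ) where

    open Coding z {d}

    Bases : ∀ {m} → (Point F τ d → Fin m) → ℕ → Set _
    Bases = DisjointRainbowBases F τ d

    -- The point numbered 0 is the zero vector, and a family containing it satisfies the nontrivial
    -- relation `δ i 1#`.
    code≢0 : ∀ {m} {col : Point F τ d → Fin m} B → RainbowBasis F τ d col B → ∀ i → 0 < toℕ (code (B i))
    code≢0 B (_ , li) i = n≢0⇒n>0 λ eq → K.1≉0 (K.trans (δ-diagonal i) (LI⇒independent (vec F τ d ∘ B) li (δ i K.1#) (λ l →
      K.trans (comb-δ i K.1# (vec F τ d ∘ B) l) (K.trans (K.*-identityˡ _) (K.trans (K.reflexive (cong τ (code-zero (B i) eq l))) τz≈0))) i))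
      where
      δ-diagonal : ∀ {n} (i : Fin n) {b} → b K.≈ δ i b i
      δ-diagonal zero = K.refl
      δ-diagonal (suc i) = δ-diagonal i

    -- The selected points are distinct and nonzero, and the number 0 of the zero vector is one
    -- further number below `s`; this makes the inequality strict.
    selection-bound : ∀ {m} (col : Point F τ d → Fin m) {t r s} (bases : Bases col t) → 0 < s →
      (sel : Fin t → Fin r → Fin d) → (∀ j → Injective _≡_ _≡_ (sel j)) →
      (∀ j i → toℕ (code (proj₁ bases j (sel j i))) < s) → t * r < s
    selection-bound col {t} {r} {s} (B , rainbow , disjoint) 0<s sel sel-inj low = injective⇒≤ {f = f} f-inj
      where
      position : Fin (t * r) → Fin t × Fin r
      position = remQuot {t} r
      e : Fin (t * r) → Point F τ d
      e q = B (proj₁ (position q)) (sel (proj₁ (position q)) (proj₂ (position q)))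
      f : Fin (suc (t * r)) → Fin s
      f zero = fromℕ< 0<s
      f (suc q) = fromℕ< (low (proj₁ (position q)) (proj₂ (position q)))
      f-zero : toℕ (f zero) ≡ 0
      f-zero = toℕ-fromℕ< 0<s
      f-suc : ∀ q → toℕ (f (suc q)) ≡ toℕ (code (e q))
      f-suc q = toℕ-fromℕ< (low (proj₁ (position q)) (proj₂ (position q)))
      positive : ∀ q → 0 < toℕ (code (e q))
      positive q = code≢0 {col = col} (B (proj₁ (position q))) (rainbow (proj₁ (position q))) _
      same : ∀ {j j′ i i′} → B j (sel j i) ≡ B j′ (sel j′ i′) → (j , i) ≡ (j′ , i′)
      same {j} {j′} {i} {i′} eq with refl ← disjoint j j′ _ _ eq = cong (j ,_) (sel-inj j (proj₁ (rainbow j) (cong col eq)))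
      f-inj : Injective _≡_ _≡_ f
      f-inj {zero} {zero} eq = refl
      f-inj {zero} {suc q} eq = contradiction (trans (sym f-zero) (trans (cong toℕ eq) (f-suc q))) (<⇒≢ (positive q))
      f-inj {suc q} {zero} eq = contradiction (trans (sym f-zero) (trans (cong toℕ (sym eq)) (f-suc q))) (<⇒≢ (positive q))
      f-inj {suc q} {suc q′} eq = cong suc (trans (sym (combine-remQuot {t} r q)) (trans (cong (uncurry combine)
        (same (code-injective (toℕ-injective (trans (sym (f-suc q)) (trans (cong toℕ eq) (f-suc q′)))))))
        (combine-remQuot {t} r q′)))

    -- Both extremal colourings give private colours to the points numbered below some s: for s = t (d - 1) one
    -- private colour is wasted on the zero vector, for s = k ^ (d - 2) + t - 1 most are spent on a flat of corank 2.
    truncated : ∀ s → Point F τ d → Fin (suc s)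
    truncated s x = fromℕ< {m = toℕ (code x) ⊓ s} (s≤s (m⊓n≤n _ s))

    toℕ-truncated : ∀ s x → toℕ (truncated s x) ≡ toℕ (code x) ⊓ s
    toℕ-truncated s x = toℕ-fromℕ< (s≤s (m⊓n≤n (toℕ (code x)) s))

    truncated-surjective : ∀ {s} → s < suc k ^ d → Surjective _≡_ _≡_ (truncated s)
    truncated-surjective {s} s< y = point e , λ { refl → toℕ-injective (trans (toℕ-truncated s (point e))
        (trans (cong (_⊓ s) (trans (cong toℕ (code-point e)) (toℕ-fromℕ< y<))) (m≤n⇒m⊓n≡m (≤-pred (toℕ<n y))))) }
      where
      y< : toℕ y < suc k ^ d
      y< = ≤-trans (toℕ<n y) s<
      e = fromℕ< y<

    truncated-top : ∀ {s} x y → s ≤ toℕ (code x) → s ≤ toℕ (code y) → truncated s x ≡ truncated s y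
    truncated-top {s} x y p q = toℕ-injective (trans (toℕ-truncated s x) (trans (m≥n⇒m⊓n≡n p)
      (sym (trans (toℕ-truncated s y) (m≥n⇒m⊓n≡n q)))))

  module Bounds {k : ℕ} (τ : Fin (suc k) → K.Carrier) (τ-inj : Injective _≡_ K._≈_ τ) (z : Fin (suc k)) (τz≈0 : τ z K.≈ K.0#)
    (n : ℕ) where

    private
      d : ℕ
      d = suc (suc n)
    open Coding z {d}
    open Points τ z τz≈0 d

    -- The points numbered from `s` on share a colour, so a rainbow basis has at most one of them;
    -- `p` is its index, or an arbitrary one if there is none.
    all-but-one-low : ∀ {s} B → RainbowBasis F τ d (truncated s) B → ∃[ p ] ∀ i → toℕ (code (B (punchIn p i))) < s
    all-but-one-low {s} B (inj , _) with any? (λ i → s ≤? toℕ (code (B i)))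
    ... | no none = zero , λ i → ≰⇒> λ le → none (_ , le)
    ... | yes (p , top) = p , λ i → ≰⇒> λ le → punchInᵢ≢i p i (inj (truncated-top {s} (B (punchIn p i)) (B p) le top))

    -- Only `suc k ^ d ∸ 1` points are nonzero, too few for `t` disjoint bases.
    all-distinct : ∀ {t} → suc k ^ d ∸ 1 < t * d → Admissible F τ d t (suc k ^ d)
    all-distinct {t} big = code , (λ e → point e , λ { refl → code-point e }) , λ bases →
      <⇒≱ (selection-bound code bases (m^n>0 (suc k) d) (λ _ → id) (λ _ → id) (λ j i → toℕ<n (code (proj₁ bases j i)))) (≤-trans (m≤n+m∸n _ 1) big)

    all-distinct-max : ∀ {t m} → Admissible F τ d t m → m ≤ suc k ^ d
    all-distinct-max (col , surj , _) = injective⇒≤ {f = λ c → code (proj₁ (surj c))} λ {c} {c′} eq →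
      trans (sym (proj₂ (surj c) refl)) (trans (cong col (code-injective eq)) (proj₂ (surj c′) refl))

    -- Each rainbow basis has `suc n` elements numbered below `t * suc n`; counting the zero vector,
    -- `t` disjoint ones would need `t * suc n + 1` such numbers.
    hide-zero : ∀ {t} → 1 ≤ t → t * d < suc k ^ d → Admissible F τ d t (1 + t * suc n)
    hide-zero {t} 1≤t fits = truncated s , truncated-surjective s< , λ bases@(B , rainbow , _) →
      <-irrefl refl (selection-bound (truncated s) bases 0<s (λ j → punchIn (proj₁ (all-but-one-low (B j) (rainbow j))))
        (λ j → punchIn-injective (proj₁ (all-but-one-low (B j) (rainbow j))) _ _) (λ j → proj₂ (all-but-one-low (B j) (rainbow j))))
      where
      s = t * suc n
      s< : s < suc k ^ d
      s< = ≤-<-trans (*-monoʳ-≤ t (n≤1+n (suc n))) fits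
      0<s : 0 < s
      0<s = ≤-trans 1≤t (m≤m*n t (suc n))

    -- Of d independent vectors at least two do not vanish in the first two coordinates.
    middle : ∀ {s} B → RainbowBasis F τ d (truncated s) B → ∃[ i ] (suc k ^ n ≤ toℕ (code (B i)) × toℕ (code (B i)) < s)
    middle {s} B rb@(_ , li) with any? (λ i → (suc k ^ n ≤? toℕ (code (B i))) ×-dec (toℕ (code (B i)) <? s))
    ... | yes found = found
    -- Otherwise the `suc n` elements other than the one at `p` lie in the flat. Their last `n`
    -- coordinates are then dependent, and the relation extends by 0 at `p` to the whole basis.
    ... | no none = ⊥-elim (gauss n w λ { (inj₁ (_ , le)) → <-irrefl refl le ; (inj₂ dep) → absurd dep })
      where
      p = proj₁ (all-but-one-low B rb)
      v : Fin d → Fin d → K.Carrier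
      v i = vec F τ d (B i)
      w : Fin (suc n) → Fin n → K.Carrier
      w i l = v (punchIn p i) (suc (suc l))
      flat : ∀ i → lookup (B (punchIn p i)) zero ≡ z × lookup (B (punchIn p i)) (suc zero) ≡ z
      flat i = code-low z (B (punchIn p i)) (≰⇒> λ le → none (_ , le , proj₂ (all-but-one-low B rb) i))
      absurd : Dependent w → ⊥
      absurd (a , i , ai≉0 , h) = ai≉0 (K.trans (K.reflexive (sym (insertAt-punchIn a p K.0# i))) (LI⇒independent v li a′ vanish (punchIn p i)))
        where
        a′ = insertAt a p K.0#
        column-zero : ∀ l → (∀ i → lookup (B (punchIn p i)) l ≡ z) → comb a (v ∘ punchIn p) l K.≈ K.0#
        column-zero l eq = sum-zero (λ i → a i K.* v (punchIn p i) l)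
          λ i → K.trans (K.*-congˡ (K.trans (K.reflexive (cong τ (eq i))) τz≈0)) (K.zeroʳ (a i))
        vanish : ∀ l → comb a′ v l K.≈ K.0#
        vanish zero = K.trans (comb-insertAt a p v zero) (column-zero zero (proj₁ ∘ flat))
        vanish (suc zero) = K.trans (comb-insertAt a p v (suc zero)) (column-zero (suc zero) (proj₂ ∘ flat))
        vanish (suc (suc l)) = K.trans (comb-insertAt a p v (suc (suc l))) (h l)

    -- By `middle` every rainbow basis contains a point numbered from `suc k ^ n` up to below `s`.
    -- After `suc t` is matched, there are `t` such numbers against `suc t` disjoint bases.
    hide-flat : ∀ {t} → 1 ≤ t → suc k ^ n + t ≤ suc k ^ d → Admissible F τ d t (suc k ^ n + t)
    hide-flat {suc t} _ fits = subst (Admissible F τ d (suc t)) (sym (+-suc (suc k ^ n) t))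
      (truncated s , truncated-surjective (subst (_≤ suc k ^ d) (+-suc (suc k ^ n) t) fits) , refute)
      where
      s = suc k ^ n + t
      refute : ¬ Bases (truncated s) (suc t)
      refute (B , rainbow , disjoint) = <-irrefl refl (injective⇒≤ {f = f} f-inj)
        where
        i* : ∀ j → ∃[ i ] (suc k ^ n ≤ toℕ (code (B j i)) × toℕ (code (B j i)) < s)
        i* j = middle (B j) (rainbow j)
        x : Fin (suc t) → Point F τ d
        x j = B j (proj₁ (i* j))
        bound : ∀ j → toℕ (code (x j)) ∸ suc k ^ n < t
        bound j = subst (toℕ (code (x j)) ∸ suc k ^ n <_) (m+n∸m≡n (suc k ^ n) t)
          (∸-monoˡ-< (proj₂ (proj₂ (i* j))) (proj₁ (proj₂ (i* j))))
        f : Fin (suc t) → Fin t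
        f j = fromℕ< (bound j)
        f-inj : Injective _≡_ _≡_ f
        f-inj {j} {j′} eq = disjoint j j′ _ _ (code-injective (toℕ-injective (∸-cancelʳ-≡ (proj₁ (proj₂ (i* j))) (proj₁ (proj₂ (i* j′)))
          (trans (sym (toℕ-fromℕ< (bound j))) (trans (cong toℕ eq) (toℕ-fromℕ< (bound j′)))))))

    -- As the goal is a negation, spans may be assumed decidable. The rank is `suc (suc n)`, so the
    -- parameter `d` of `AntiRamsey` is `suc n`; `many` is its condition `g-m`, and `g-N` comes from
    -- `fits`.
    upper : 2 ≤ suc k → ∀ {t m} → 1 ≤ t → t * d < suc k ^ d →
      (∀ r → r < suc n → suc k ^ r + suc (t * suc n) ≤ m + t * r) → ¬ Admissible F τ d t m
    upper 2≤k {suc t} {m} _ fits many (col , surj , none) = span-dec v λ dec → with-dec dec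
      where
      coord : Fin (suc k ^ d) → Fin d → Fin (suc k)
      coord e = lookup (point e)
      coord-inj : ∀ e e′ → (∀ l → coord e l ≡ coord e′ l) → e ≡ e′
      coord-inj e e′ eq = trans (sym (code-point e)) (trans (cong code (trans (sym (tabulate∘lookup (point e)))
        (trans (tabulate-cong eq) (tabulate∘lookup (point e′))))) (code-point e′))
      v : Fin (suc k ^ d) → Fin d → K.Carrier
      v e = vec F τ d (point e)
      with-dec : SpanDec v → ⊥
      with-dec dec = AR.disjoint-rainbow-bases ((λ c → code (proj₁ (surj c))) , λ c → proj₂ (surj c) (point-code _)) λ
          { (a , valid , full , rainbow) → finish a valid full rainbow }
        where
        module SM = SpanMatroid v dec
        module AR = AntiRamsey SM.spanMatroid {suc t} zero (col ∘ point) (suc n) (suc k ^_) SM.rank≤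
          (λ V? _ → flat≤ τ τ-inj coord coord-inj dec V?)
          (flat-bound 2≤k {suc t} (subst (_≤ suc k ^ d) (+-comm 1 (suc t * d)) fits)) many (^-monoʳ-< (suc k) 2≤k (n<1+n (suc n)))
        finish : (a : Assignment (suc k ^ d) (suc t)) → (∀ j → Matroid.Ind SM.spanMatroid (Slot a j)) →
          (∀ j → d ≤ count (slot? a j)) →
          (∀ x y j → Slot a j x → Slot a j y → col (point x) ≡ col (point y) → x ≡ y) → ⊥
        finish a valid full rainbow = ¬¬-∀ (λ j → SM.independent-family (f j) (f-inj j) (f∈ j) (valid j)) λ ind →
          none ((λ j i → point (f j i)) ,
            (λ j → (λ eq → f-inj j (rainbow _ _ j (f∈ j _) (f∈ j _) eq)) , independent⇒LI (v ∘ f j) (proj₁ (ind j))) ,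
            λ j j′ i i′ eq → slot-unique {a = a} (f∈ j i) (subst (Slot a j′) (sym (point-injective eq)) (f∈ j′ i′)))
          where
          f : Fin (suc t) → Fin d → Fin (suc k ^ d)
          f j i = enum (slot? a j) (inject≤ i (full j))
          f∈ : ∀ j i → Slot a j (f j i)
          f∈ j i = enum-∈ (slot? a j) (inject≤ i (full j))
          f-inj : ∀ j → Injective _≡_ _≡_ (f j)
          f-inj j eq = inject≤-injective (full j) (full j) _ _ (enum-injective (slot? a j) eq)
          point-injective : ∀ {e e′} → point e ≡ point e′ → e ≡ e′
          point-injective {e} {e′} eq = trans (sym (code-point e)) (trans (cong code eq) (code-point e′))

theorem20 : {c ℓ : Level} (F : Field c ℓ) (k : ℕ) (τ : Fin k → Field.Carrier F) →
    Injective _≡_ (Field._≈_ F) τ → (Σ[ z ∈ Fin k ] Field._≈_ F (τ z) (Field.0# F)) → 2 ≤ k →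
    (d : ℕ) → 2 ≤ d → (t : ℕ) → 1 ≤ t →
    ((k ^ d ∸ 1 < t * d) → IsAr F τ d t (k ^ d)) ×
    ((k ^ (d ∸ 2) ∸ 1 ≤ t * (d ∸ 2)) → t * d ≤ k ^ d ∸ 1 → IsAr F τ d t (1 + t * (d ∸ 1))) ×
    ((t * (d ∸ 2) ≤ k ^ (d ∸ 2) ∸ 1) → t * d ≤ k ^ d ∸ 1 → IsAr F τ d t (k ^ (d ∸ 2) + t))
theorem20 F (suc k) τ τ-inj (z , τz≈0) 2≤k (suc (suc n)) (s≤s (s≤s z≤n)) t 1≤t =
  (λ big → all-distinct big , λ m → all-distinct-max) ,
  (λ slow fits → hide-zero 1≤t (below d fits) , λ m adm → ≮⇒≥ λ lt →
    upper 2≤k 1≤t (below d fits) (colour-bound-slow 2≤k {t} (≤-trans (m≤n+m∸n (suc k ^ n) 1)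
      (≤-trans (s≤s slow) (≤-reflexive (+-comm 1 (t * n))))) lt) adm) ,
  (λ fast fits → hide-flat 1≤t (room 2≤k {t} n (subst (_≤ suc k ^ d) (+-comm 1 (t * d)) (below d fits))) , λ m adm → ≮⇒≥ λ lt →
    upper 2≤k 1≤t (below d fits) (colour-bound-fast 2≤k {t} (subst (_≤ suc k ^ n) (+-comm 1 (t * n)) (below n fast)) lt) adm)
  where
  open Bounds F τ τ-inj z τz≈0 n
  d : ℕ
  d = suc (suc n)
  below : ∀ q {a} → a ≤ suc k ^ q ∸ 1 → a < suc k ^ q
  below q = m≤pred[n]⇒suc[m]≤n {{m^n≢0 (suc k) q}}
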